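{- Let $\mathsf{IAF}=(A^F,R^F,A^?,R^?)$ be an incomplete argumentation framework, $\sigma\in\{st,co,gr,pr,se,id,ea,na,stg\}$, and $a\in A^F$. Then: (1) the answer to $\sigma$-NSA with input $\mathsf{IAF}$ and $a$ is yes iff $v_{\mathsf{IAF}}\models[\mathsf{makeComp}^{\mathsf{IAF}};\mathsf{makeExt}^\sigma]\mathtt{in}_a$; (2) the answer to $\sigma$-NCA with input $\mathsf{IAF}$ and $a$ is yes iff $v_{\mathsf{IAF}}\models[\mathsf{makeComp}^{\mathsf{IAF}}]\langle\mathsf{makeExt}^\sigma\rangle\mathtt{in}_a$; (3) the answer to $\sigma$-PCA with input $\mathsf{IAF}$ and $a$ is yes iff $v_{\mathsf{IAF}}\models\langle\mathsf{makeComp}^{\mathsf{IAF}};\mathsf{makeExt}^\sigma\rangle\mathtt{in}_a$; (4) the answer to $\sigma$-PSA with input $\mathsf{IAF}$ and $a$ is yes iff $v_{\mathsf{IAF}}\models\langle\mathsf{makeComp}^{\mathsf{IAF}}\rangle[\mathsf{makeExt}^\sigma]\mathtt{in}_a$.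
   Context: **Argumentation.** Fix a finite non-empty set $\mathcal U$ of arguments. For $A\subseteq\mathcal U$, $R\subseteq\mathcal U\times\mathcal U$, let $R\upharpoonright_A=R\cap(A\times A)$. An argumentation framework (AF) is a pair $(A,R)$ with $A\subseteq\mathcal U$, $R\subseteq A\times A$. For $E\subseteq A$: $E^+=\{x\in A\mid\exists y\in E:(y,x)\in R\}$, $E^\oplus=E\cup E^+$ (range). $E$ is conflict-free iff $E\cap E^+=\emptyset$; $E$ defends $a\in A$ iff every $x\in A$ with $(x,a)\in R$ is in $E^+$; $E$ is admissible iff it is conflict-free and defends all its members. $\sigma(A,R)$ denotes the set of $\sigma$-extensions of $(A,R)$, where $E\subseteq A$ is: stable ($st$) iff conflict-free and $A\setminus E\subseteq E^+$; complete ($co$) iff conflict-free and $E$ contains precisely the arguments of $A$ it defends; grounded ($gr$) iff a $\subseteq$-minimal complete extension; preferred ($pr$) iff a $\subseteq$-maximal complete extension; semi-stable ($se$) iff complete and there is no complete $E'$ with $E^\oplus\subset E'^\oplus$ (strict); ideal ($id$) iff the $\subseteq$-maximal ideal set, an ideal set being an admissible set contained in every preferred extension; eager ($ea$) iff the $\subseteq$-maximal eager set, an eager set being an admissible set contained in every semi-stable extension; naive ($na$) iff a $\subseteq$-maximal conflict-free set; stage ($stg$) iff conflict-free with $\subseteq$-maximal range among conflict-free sets. **Incomplete AFs.** An incomplete AF (IAF) is $(A^F,R^F,A^?,R^?)$ with $A^F,A^?\subseteq\mathcal U$ disjoint, and $R^F,R^?\subseteq(A^F\cup A^?)\times(A^F\cup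 A^?)$ disjoint. A completion is any AF $(A^*,R^*)$ with $A^F\subseteq A^*\subseteq A^F\cup A^?$ and $R^F\upharpoonright_{A^*}\subseteq R^*\subseteq(R^F\cup R^?)\upharpoonright_{A^*}$. Decision problems for input an IAF and $a\in A^F$: $\sigma$-NSA (necessary sceptical acceptance): for every completion $(A^*,R^*)$ and every $E\in\sigma(A^*,R^*)$, $a\in E$? $\sigma$-NCA (necessary credulous): for every completion there is $E\in\sigma(A^*,R^*)$ with $a\in E$? $\sigma$-PCA (possible credulous): is there a completion and an $E\in\sigma(A^*,R^*)$ with $a\in E$? $\sigma$-PSA (possible sceptical): is there a completion such that $a\in E$ for every $E\in\sigma(A^*,R^*)$? **DL-PA.** $\mathtt{Prp}$ is a countably infinite set of propositional variables containing the pairwise distinct variables $\mathtt{aw}_x$, $\mathtt{in}_x$ ($x\in\mathcal U$), $\mathtt r_{x,y}$ ($x,y\in\mathcal U$), and further fresh variables $\mathtt{in}'_x$ ($x\in\mathcal U$). Let $\mathsf{IN}_{\mathcal U}=\{\mathtt{in}_x\mid x\in\mathcal U\}$, $\mathsf{AW}_A=\{\mathtt{aw}_x\mid x\in A\}$, $\mathsf{ATT}_R=\{\mathtt r_{x,y}\mid(x,y)\in R\}$. Formulas and programs: $\varphi::=p\mid\neg\varphi\mid(\varphi\wedge\varphi)\mid[\pi]\varphi$ and $\pi::=+p\mid -p\mid\varphi?\mid(\pi;\pi)\mid(\pi\cup\pi)\mid\pi^{ -1}$, $p\in\mathtt{Prp}$. Valuations are subsets $v\subseteq\mathtt{Prp}$;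 $v\models p$ iff $p\in v$; Booleans as usual; $v\models[\pi]\varphi$ iff $v'\models\varphi$ for all $v'$ with $(v,v')\in||\pi||$; $\langle\pi\rangle\varphi=\neg[\pi]\neg\varphi$. Programs are interpreted by $||+p||=\{(v,v\cup\{p\})\}$, $||-p||=\{(v,v\setminus\{p\})\}$, $||\varphi?||=\{(v,v)\mid v\models\varphi\}$, $;$ is relation composition, $\cup$ is union, $\pi^{ -1}$ is the inverse relation. $\mathsf{skip}=\top?$. For finite $P=\{p_1,\dots,p_n\}\subseteq\mathtt{Prp}$: $\mathsf{mkTrueOne}(P)=\bigcup_{p\in P}(\neg p?;+p)$, $\mathsf{mkFalseOne}(P)=\bigcup_{p\in P}(p?;-p)$, $\mathsf{mkTrueSome}(P)=(+p_1\cup\mathsf{skip});\dots;(+p_n\cup\mathsf{skip})$, $\mathsf{mkFalseSome}(P)=(-p_1\cup\mathsf{skip});\dots;(-p_n\cup\mathsf{skip})$, $\mathsf{vary}(P)=(+p_1\cup -p_1);\dots;(+p_n\cup -p_n)$ (empty sequences and unions are $\mathsf{skip}$). **Extension programs.** For each $\sigma$, $\mathsf{makeExt}^\sigma=\mathsf{vary}(\mathsf{IN}_{\mathcal U});\varphi_\sigma?$, where $\varphi_{st}=\mathsf{Stable}$, $\varphi_{co}=\mathsf{Complete}$, $\varphi_{gr}=\mathsf{Grounded}$, $\varphi_{pr}=\mathsf{Preferred}$, $\varphi_{na}=\mathsf{Naive}$, $\varphi_{se}=\mathsf{SemiStable}$, $\varphi_{stg}=\mathsf{Stage}$, $\varphi_{id}=\mathsf{Ideal}$,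 $\varphi_{ea}=\mathsf{Eager}$ are the following (all indices range over $\mathcal U$): $\mathsf{Well}=\bigwedge_x(\mathtt{in}_x\to\mathtt{aw}_x)$; $\mathsf{ConFree}=\mathsf{Well}\wedge\bigwedge_x\bigwedge_y\neg(\mathtt{in}_x\wedge\mathtt{in}_y\wedge\mathtt r_{x,y})$; $\mathsf{Admissible}=\mathsf{ConFree}\wedge\bigwedge_x(\mathtt{in}_x\to\bigwedge_y((\mathtt{aw}_y\wedge\mathtt r_{y,x})\to\bigvee_z(\mathtt{in}_z\wedge\mathtt r_{z,y})))$; $\mathsf{copy}(\mathsf{IN}_{\mathcal U})$ = sequential composition over $x\in\mathcal U$ of $(\mathtt{in}_x?;+\mathtt{in}'_x)\cup(\neg\mathtt{in}_x?;-\mathtt{in}'_x)$; $\mathsf{Rg}_x=\mathtt{in}_x\vee(\mathtt{aw}_x\wedge\bigvee_y(\mathtt{in}_y\wedge\mathtt r_{y,x}))$, $\mathsf{Rg}'_x=\mathtt{in}'_x\vee(\mathtt{aw}_x\wedge\bigvee_y(\mathtt{in}'_y\wedge\mathtt r_{y,x}))$, $\mathsf{IncludedInCp}=\bigwedge_x(\mathsf{Rg}_x\to\mathsf{Rg}'_x)$, $\mathsf{IncludesCp}=\bigwedge_x(\mathsf{Rg}'_x\to\mathsf{Rg}_x)$; $\mathsf{Stable}=\mathsf{Well}\wedge\bigwedge_x(\mathtt{aw}_x\to(\mathtt{in}_x\leftrightarrow\neg\bigvee_y(\mathtt{in}_y\wedge\mathtt r_{y,x})))$; $\mathsf{Complete}=\mathsf{ConFree}\wedge\bigwedge_x(\mathtt{in}_x\leftrightarrow\bigwedge_y((\mathtt{aw}_y\wedge\mathtt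 r_{y,x})\to\bigvee_z(\mathtt{in}_z\wedge\mathtt r_{z,y})))$; $\mathsf{Grounded}=\mathsf{Complete}\wedge[\mathsf{mkFalseOne}(\mathsf{IN}_{\mathcal U});\mathsf{mkFalseSome}(\mathsf{IN}_{\mathcal U})]\neg\mathsf{Complete}$; $\mathsf{Preferred}=\mathsf{Admissible}\wedge[\mathsf{mkTrueOne}(\mathsf{IN}_{\mathcal U});\mathsf{mkTrueSome}(\mathsf{IN}_{\mathcal U})]\neg\mathsf{Admissible}$; $\mathsf{Naive}=\mathsf{ConFree}\wedge[\mathsf{mkTrueOne}(\mathsf{IN}_{\mathcal U})]\neg\mathsf{ConFree}$; $\mathsf{SemiStable}=\mathsf{Complete}\wedge[\mathsf{copy}(\mathsf{IN}_{\mathcal U});\mathsf{makeExt}^{co}](\mathsf{IncludesCp}\to\mathsf{IncludedInCp})$; $\mathsf{Stage}=\mathsf{ConFree}\wedge[\mathsf{copy}(\mathsf{IN}_{\mathcal U});\mathsf{vary}(\mathsf{IN}_{\mathcal U});\mathsf{ConFree}?](\mathsf{IncludesCp}\to\mathsf{IncludedInCp})$; $\mathsf{IdealSet}=\mathsf{Admissible}\wedge\bigwedge_x(\mathtt{in}_x\to[\mathsf{makeExt}^{pr}]\mathtt{in}_x)$, $\mathsf{EagerSet}=\mathsf{Admissible}\wedge\bigwedge_x(\mathtt{in}_x\to[\mathsf{makeExt}^{se}]\mathtt{in}_x)$; $\mathsf{Ideal}=\mathsf{IdealSet}\wedge[\mathsf{mkTrueOne}(\mathsf{IN}_{\mathcal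 U});\mathsf{mkTrueSome}(\mathsf{IN}_{\mathcal U})]\neg\mathsf{IdealSet}$; $\mathsf{Eager}=\mathsf{EagerSet}\wedge[\mathsf{mkTrueOne}(\mathsf{IN}_{\mathcal U});\mathsf{mkTrueSome}(\mathsf{IN}_{\mathcal U})]\neg\mathsf{EagerSet}$. **Encoding of IAFs.** $v_{\mathsf{IAF}}=\mathsf{AW}_{A^F}\cup\mathsf{ATT}_{R^F}$ and $\mathsf{makeComp}^{\mathsf{IAF}}=\mathsf{mkTrueSome}(\mathsf{AW}_{A^?});\mathsf{mkTrueSome}(\mathsf{ATT}_{R^?})$.
   Formalization: In Complete (used for co, gr, se, ea) the biconditional for x is required only if aw_x holds; as printed, Complete is unsatisfiable when an unattacked argument lies outside the framework (e.g. U={a,b}, A^F={a}, all else empty), so the claim fails. -}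

module Defs where

open import Data.Bool using (Bool; true; false; if_then_else_)
open import Data.Fin using (Fin)
open import Data.Fin.Properties using () renaming (_≟_ to _≟ᶠ_)
open import Data.Fin.Subset using (Subset; _∈_; _∉_; _⊆_; _⊂_; _∪_; _∩_; Empty)
open import Data.Fin.Subset.Properties using (_∈?_)
open import Data.List using (List; []; _∷_; _++_; map; foldr; filter; allFin; cartesianProduct)
open import Data.List.Membership.DecPropositional using () renaming (_∈?_ to mem?)
open import Data.Nat using (ℕ)
open import Data.Nat.Properties using () renaming (_≟_ to _≟ⁿ_)
open import Data.Product using (_×_; _,_; ∃-syntax; uncurry)
open import Data.Product.Properties using () renaming (≡-dec to ×-≡-dec)
open import Data.Sum using (_⊎_; inj₁; inj₂)
open import Data.Sum.Properties using () renaming (≡-dec to ⊎-≡-dec)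
open import Function using (_⇔_)
open import Level using (0ℓ)
open import Relation.Binary using (Rel; _⇒_; DecidableEquality)
open import Relation.Binary.PropositionalEquality using (_≡_; _≗_; refl; sym; trans; cong)
open import Relation.Nullary using (¬_; does)
open import Relation.Nullary.Decidable using (map′)
open import Relation.Unary using (Pred) renaming (_⊂_ to _⊂ᴾ_)

-- The finite universe 𝓤 of arguments is Fin n throughout.

private variable
  n : ℕ

------------------------------------------------------------------------
-- Argumentation frameworks

-- A relation R ⊆ 𝓤 × 𝓤, given by its rows: (x , y) ∈ R iff y ∈ R x.
Attacks : ℕ → Set
Attacks n = Fin n → Subset n

Att : Attacks n → Rel (Fin n) 0ℓ
Att R x y = y ∈ R x

_↾_ : Attacks n → Subset n → Rel (Fin n) 0ℓ
(R ↾ A) x y = Att R x y × x ∈ A × y ∈ A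

_∪ᴿ_ : Attacks n → Attacks n → Attacks n
(R ∪ᴿ S) x = R x ∪ S x

record AF (n : ℕ) : Set where
  field
    args    : Subset n
    att     : Attacks n
    att-on  : ∀ {x y} → Att att x y → x ∈ args × y ∈ args

module _ (F : AF n) where
  open AF F

  infix 10 _⁺ _⊕

  _⁺ : Subset n → Pred (Fin n) 0ℓ
  (E ⁺) x = x ∈ args × ∃[ y ] (y ∈ E × Att att y x)

  _⊕ : Subset n → Pred (Fin n) 0ℓ
  (E ⊕) x = x ∈ E ⊎ (E ⁺) x

  -- The standing requirement E ⊆ A is made part of conflict-freeness,
  -- on which all the other notions are built.
  ConflictFree : Subset n → Set
  ConflictFree E = E ⊆ args × (∀ {x} → x ∈ E → ¬ (E ⁺) x)

  Defends : Subset n → Fin n → Set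
  Defends E a = ∀ {x} → x ∈ args → Att att x a → (E ⁺) x

  AdmissibleSet : Subset n → Set
  AdmissibleSet E = ConflictFree E × (∀ {a} → a ∈ E → Defends E a)

  StableExt : Subset n → Set
  StableExt E = ConflictFree E × (∀ {x} → x ∈ args → x ∉ E → (E ⁺) x)

  CompleteExt : Subset n → Set
  CompleteExt E = ConflictFree E × (∀ {a} → a ∈ args → (a ∈ E ⇔ Defends E a))

  Minimal Maximal MaximalRange : Pred (Subset n) 0ℓ → Pred (Subset n) 0ℓ
  Minimal P E = P E × (∀ E′ → P E′ → ¬ (E′ ⊂ E))
  Maximal P E = P E × (∀ E′ → P E′ → ¬ (E ⊂ E′))
  MaximalRange P E = P E × (∀ E′ → P E′ → ¬ (E ⊕ ⊂ᴾ E′ ⊕))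

  GroundedExt PreferredExt SemiStableExt NaiveExt StageExt : Subset n → Set
  GroundedExt   = Minimal CompleteExt
  PreferredExt  = Maximal CompleteExt
  SemiStableExt = MaximalRange CompleteExt
  NaiveExt      = Maximal ConflictFree
  StageExt      = MaximalRange ConflictFree

  IsIdealSet IsEagerSet : Subset n → Set
  IsIdealSet E = AdmissibleSet E × (∀ E′ → PreferredExt E′ → E ⊆ E′)
  IsEagerSet E = AdmissibleSet E × (∀ E′ → SemiStableExt E′ → E ⊆ E′)

  IdealExt EagerExt : Subset n → Set
  IdealExt = Maximal IsIdealSet
  EagerExt = Maximal IsEagerSet

data Semantics : Set where
  st co gr pr se id ea na stg : Semantics

Extension : Semantics → AF n → Subset n → Set
Extension st  = StableExt
Extension co  = CompleteExt
Extension gr  = GroundedExt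
Extension pr  = PreferredExt
Extension se  = SemiStableExt
Extension id  = IdealExt
Extension ea  = EagerExt
Extension na  = NaiveExt
Extension stg = StageExt

------------------------------------------------------------------------
-- Incomplete argumentation frameworks

record IAF (n : ℕ) : Set where
  field
    Aᶠ A?         : Subset n
    Rᶠ R?         : Attacks n
    args-disjoint : Empty (Aᶠ ∩ A?)
    att-disjoint  : ∀ x → Empty (Rᶠ x ∩ R? x)
    Rᶠ-on         : ∀ {x y} → Att Rᶠ x y → x ∈ Aᶠ ∪ A? × y ∈ Aᶠ ∪ A?
    R?-on         : ∀ {x y} → Att R? x y → x ∈ Aᶠ ∪ A? × y ∈ Aᶠ ∪ A?

record IsCompletion (I : IAF n) (F : AF n) : Set where
  open IAF I
  open AF F
  field
    args-lower : Aᶠ ⊆ args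
    args-upper : args ⊆ Aᶠ ∪ A?
    att-lower  : (Rᶠ ↾ args) ⇒ Att att
    att-upper  : Att att ⇒ ((Rᶠ ∪ᴿ R?) ↾ args)

NSA NCA PCA PSA : Semantics → IAF n → Fin n → Set
NSA σ I a = ∀ F → IsCompletion I F → ∀ E → Extension σ F E → a ∈ E
NCA σ I a = ∀ F → IsCompletion I F → ∃[ E ] (Extension σ F E × a ∈ E)
PCA σ I a = ∃[ F ] (IsCompletion I F × ∃[ E ] (Extension σ F E × a ∈ E))
PSA σ I a = ∃[ F ] (IsCompletion I F × (∀ E → Extension σ F E → a ∈ E))

------------------------------------------------------------------------
-- DL-PA

-- The constructor `other` supplies the remaining variables of the
-- countably infinite set Prp; `inn′` is the fresh copy of `inn`.
data Prp (n : ℕ) : Set where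
  aw inn inn′ : Fin n → Prp n
  r           : Fin n → Fin n → Prp n
  other       : ℕ → Prp n

private
  Code : ℕ → Set
  Code n = Fin n ⊎ Fin n ⊎ Fin n ⊎ (Fin n × Fin n) ⊎ ℕ

  encode : Prp n → Code n
  encode (aw x)    = inj₁ x
  encode (inn x)   = inj₂ (inj₁ x)
  encode (inn′ x)  = inj₂ (inj₂ (inj₁ x))
  encode (r x y)   = inj₂ (inj₂ (inj₂ (inj₁ (x , y))))
  encode (other k) = inj₂ (inj₂ (inj₂ (inj₂ k)))

  decode : Code n → Prp n
  decode (inj₁ x)                             = aw x
  decode (inj₂ (inj₁ x))                      = inn x
  decode (inj₂ (inj₂ (inj₁ x)))               = inn′ x
  decode (inj₂ (inj₂ (inj₂ (inj₁ (x , y))))) = r x y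
  decode (inj₂ (inj₂ (inj₂ (inj₂ k))))        = other k

  decode-encode : (p : Prp n) → decode (encode p) ≡ p
  decode-encode (aw x)    = refl
  decode-encode (inn x)   = refl
  decode-encode (inn′ x)  = refl
  decode-encode (r x y)   = refl
  decode-encode (other k) = refl

infix 4 _≟_

_≟_ : DecidableEquality (Prp n)
p ≟ q = map′ (λ e → trans (sym (decode-encode p)) (trans (cong decode e) (decode-encode q)))
             (cong encode)
             (⊎-≡-dec _≟ᶠ_ (⊎-≡-dec _≟ᶠ_ (⊎-≡-dec _≟ᶠ_ (⊎-≡-dec (×-≡-dec _≟ᶠ_ _≟ᶠ_) _≟ⁿ_)))
               (encode p) (encode q))

infixr 20 ~_ [_]_ ⟨_⟩_ +̇_ -̇_
infix  21 _⁻¹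
infix  19 _¿
infixr 18 _∧_
infixr 17 _∨_
infixr 16 _⟶_ _⟷_
infixr 15 _⨾_
infixr 14 _∪ᵖ_

mutual
  data Formula (n : ℕ) : Set where
    var  : Prp n → Formula n
    ~_   : Formula n → Formula n
    _∧_  : Formula n → Formula n → Formula n
    [_]_ : Program n → Formula n → Formula n

  data Program (n : ℕ) : Set where
    +̇_ -̇_   : Prp n → Program n
    _¿       : Formula n → Program n
    _⨾_ _∪ᵖ_ : Program n → Program n → Program n
    _⁻¹      : Program n → Program n

-- Subsets of Prp, as characteristic functions compared pointwise.
Valuation : ℕ → Set
Valuation n = Prp n → Bool

_[_≔_] : Valuation n → Prp n → Bool → Valuation n
(v [ p ≔ b ]) q = if does (p ≟ q) then b else v q

infix 4 _⊨_

mutual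
  _⊨_ : Valuation n → Formula n → Set
  v ⊨ var p   = v p ≡ true
  v ⊨ ~ φ     = ¬ (v ⊨ φ)
  v ⊨ φ ∧ ψ   = v ⊨ φ × v ⊨ ψ
  v ⊨ [ π ] φ = ∀ v′ → ∥ π ∥ v v′ → v′ ⊨ φ

  ∥_∥ : Program n → Rel (Valuation n) 0ℓ
  ∥ +̇ p ∥      v v′ = v′ ≗ v [ p ≔ true ]
  ∥ -̇ p ∥      v v′ = v′ ≗ v [ p ≔ false ]
  ∥ φ ¿ ∥      v v′ = v′ ≗ v × v ⊨ φ
  ∥ π₁ ⨾ π₂ ∥  v v′ = ∃[ u ] (∥ π₁ ∥ v u × ∥ π₂ ∥ u v′)
  ∥ π₁ ∪ᵖ π₂ ∥ v v′ = ∥ π₁ ∥ v v′ ⊎ ∥ π₂ ∥ v v′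
  ∥ π ⁻¹ ∥     v v′ = ∥ π ∥ v′ v

⟨_⟩_ : Program n → Formula n → Formula n
⟨ π ⟩ φ = ~ [ π ] (~ φ)

_∨_ _⟶_ _⟷_ : Formula n → Formula n → Formula n
φ ∨ ψ = ~ (~ φ ∧ ~ ψ)
φ ⟶ ψ = ~ (φ ∧ ~ ψ)
φ ⟷ ψ = (φ ⟶ ψ) ∧ (ψ ⟶ φ)

⊥ᶠ ⊤ᶠ : Formula n
⊥ᶠ = var (other 0) ∧ ~ var (other 0)
⊤ᶠ = ~ ⊥ᶠ

⋀ ⋁ : (Fin n → Formula n) → Formula n
⋀ φ = foldr (λ x ψ → φ x ∧ ψ) ⊤ᶠ (allFin _)
⋁ φ = foldr (λ x ψ → φ x ∨ ψ) ⊥ᶠ (allFin _)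

skip : Program n
skip = ⊤ᶠ ¿

Seq : List (Program n) → Program n
Seq = foldr _⨾_ skip

-- Not a fold: `skip` must not become a branch of a non-empty union.
Choice : List (Program n) → Program n
Choice []            = skip
Choice (π ∷ [])      = π
Choice (π ∷ π′ ∷ πs) = π ∪ᵖ Choice (π′ ∷ πs)

-- Finite sets of variables are given by enumerations.
mkTrueOne mkFalseOne mkTrueSome mkFalseSome vary : List (Prp n) → Program n
mkTrueOne   P = Choice (map (λ p → (~ var p) ¿ ⨾ +̇ p) P)
mkFalseOne  P = Choice (map (λ p → var p ¿ ⨾ -̇ p) P)
mkTrueSome  P = Seq (map (λ p → +̇ p ∪ᵖ skip) P)
mkFalseSome P = Seq (map (λ p → -̇ p ∪ᵖ skip) P)
vary        P = Seq (map (λ p → +̇ p ∪ᵖ -̇ p) P)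

IN : List (Prp n)
IN = map inn (allFin _)

AW : Subset n → List (Prp n)
AW A = map aw (filter (_∈? A) (allFin _))

ATT : Attacks n → List (Prp n)
ATT R = map (uncurry r) (filter (λ (x , y) → y ∈? R x) (cartesianProduct (allFin _) (allFin _)))

------------------------------------------------------------------------
-- Extension programs

Well ConFree Admissible Stable Complete : Formula n

Well = ⋀ λ x → var (inn x) ⟶ var (aw x)

ConFree = Well ∧ (⋀ λ x → ⋀ λ y → ~ (var (inn x) ∧ var (inn y) ∧ var (r x y)))

Defended : Fin n → Formula n
Defended x = ⋀ λ y → var (aw y) ∧ var (r y x) ⟶ (⋁ λ z → var (inn z) ∧ var (r z y))

Admissible = ConFree ∧ (⋀ λ x → var (inn x) ⟶ Defended x)

Stable = Well ∧ (⋀ λ x → var (aw x) ⟶ (var (inn x) ⟷ ~ (⋁ λ y → var (inn y) ∧ var (r y x))))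

-- The guard aw x, as in Stable, restricts the biconditional to arguments
-- of the framework.  Without it, an unattacked x outside the framework
-- would have to be in, contradicting Well, and Complete would be
-- unsatisfiable: take 𝓤 = {a , b}, Aᶠ = {a} and all else empty.
Complete = ConFree ∧ (⋀ λ x → var (aw x) ⟶ (var (inn x) ⟷ Defended x))

Grounded Preferred Naive SemiStable Stage IdealSet EagerSet Ideal Eager : Formula n

makeExtBy : Formula n → Program n
makeExtBy φ = vary IN ⨾ φ ¿

copyIN : Program n
copyIN = Seq (map (λ x → (var (inn x) ¿ ⨾ +̇ inn′ x) ∪ᵖ ((~ var (inn x)) ¿ ⨾ -̇ inn′ x)) (allFin _))

-- Rg inn and Rg inn′ are the range formulas of a set and of its copy.
Rg : (Fin n → Prp n) → Fin n → Formula n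
Rg i x = var (i x) ∨ (var (aw x) ∧ (⋁ λ y → var (i y) ∧ var (r y x)))

IncludedInCp IncludesCp : Formula n
IncludedInCp = ⋀ λ x → Rg inn x ⟶ Rg inn′ x
IncludesCp   = ⋀ λ x → Rg inn′ x ⟶ Rg inn x

Grounded   = Complete ∧ [ mkFalseOne IN ⨾ mkFalseSome IN ] (~ Complete)
Preferred  = Admissible ∧ [ mkTrueOne IN ⨾ mkTrueSome IN ] (~ Admissible)
Naive      = ConFree ∧ [ mkTrueOne IN ] (~ ConFree)
SemiStable = Complete ∧ [ copyIN ⨾ makeExtBy Complete ] (IncludesCp ⟶ IncludedInCp)
Stage      = ConFree ∧ [ copyIN ⨾ vary IN ⨾ ConFree ¿ ] (IncludesCp ⟶ IncludedInCp)
IdealSet   = Admissible ∧ (⋀ λ x → var (inn x) ⟶ [ makeExtBy Preferred ] var (inn x))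
EagerSet   = Admissible ∧ (⋀ λ x → var (inn x) ⟶ [ makeExtBy SemiStable ] var (inn x))
Ideal      = IdealSet ∧ [ mkTrueOne IN ⨾ mkTrueSome IN ] (~ IdealSet)
Eager      = EagerSet ∧ [ mkTrueOne IN ⨾ mkTrueSome IN ] (~ EagerSet)

φ[_] : Semantics → Formula n
φ[ st ]  = Stable
φ[ co ]  = Complete
φ[ gr ]  = Grounded
φ[ pr ]  = Preferred
φ[ se ]  = SemiStable
φ[ id ]  = Ideal
φ[ ea ]  = Eager
φ[ na ]  = Naive
φ[ stg ] = Stage

makeExt : Semantics → Program n
makeExt σ = makeExtBy φ[ σ ]

------------------------------------------------------------------------
-- Encoding of IAFs

module _ (I : IAF n) where
  open IAF I

  initial : Valuation n
  initial p = does (mem? _≟_ p (AW Aᶠ ++ ATT Rᶠ))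

  makeComp : Program n
  makeComp = mkTrueSome (AW A?) ⨾ mkTrueSome (ATT R?)

{-# OPTIONS --safe #-}

-- A valuation encodes a framework F in its variables aw, r and a set E of arguments in its variables
-- inn.  For each semantics σ, the formula φ[ σ ] holds at such a valuation iff E is a σ-extension of
-- F: the Boolean parts translate literally, and each modality quantifies over exactly the sets it is
-- meant to range over (all sets, the proper supersets of E, the proper subsets of E).  For preferred
-- extensions, φ[ pr ] speaks of maximal admissible sets, which are the maximal complete ones by Dung's
-- fundamental lemma.  Finally, makeComp reaches exactly the valuations that encode completions.
-- Constructively, ⟨ π ⟩ is a negated universal quantifier; it yields a witness because DL-PA is
-- decidable.

module Submission where

open import Defs
open import Data.Bool using (Bool; true; false; if_then_else_; _≤_; b≤b) renaming (_∨_ to _∨ᵇ_)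
import Data.Bool.Properties as Bool
open import Data.Empty using (⊥-elim)
open import Data.Fin using (Fin; zero; suc)
open import Data.Fin.Subset using (Subset; _∈_; _∉_; _⊆_; _⊂_; _⊃_; _∪_; ⁅_⁆)
open import Data.Fin.Subset.Induction using (⊃-wellFounded)
open import Data.Fin.Subset.Properties
  using (_∈?_; _⊂?_; anySubset?; ⊆-refl; ⊆-trans; ⊂-⊆-trans; ⊆-⊂-trans;
         p⊆p∪q; q⊆p∪q; x∈p∪q⁻; x∈p∪q⁺; x∈⁅x⁆; x∈⁅y⁆⇒x≡y)
import Data.List as List
open import Data.List using (List; []; _∷_; _++_; map; foldr; allFin; cartesianProduct)
open import Data.List.Membership.Propositional using () renaming (_∈_ to _∈ᴸ_)
open import Data.List.Membership.Propositional.Properties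
  using (∈-map⁺; ∈-map⁻; ∈-filter⁺; ∈-filter⁻; ∈-allFin; ∈-++⁺ˡ; ∈-++⁺ʳ; ∈-++⁻; ∈-cartesianProduct⁺)
open import Data.List.Membership.DecPropositional using () renaming (_∈?_ to mem?)
open import Data.List.Properties using (map-++)
open import Data.List.Relation.Unary.Any using (here; there)
open import Data.Nat using (ℕ; zero; suc; NonZero)
open import Data.Product using (_×_; _,_; proj₁; proj₂; ∃-syntax; uncurry)
open import Data.Product.Function.NonDependent.Propositional using (_×-⇔_)
import Data.Sum as Sum
open import Data.Sum using (_⊎_; inj₁; inj₂; [_,_]′)
open import Data.Sum.Function.Propositional using (_⊎-⇔_)
open import Data.Unit using (⊤; tt)
open import Data.Vec using (lookup; tabulate)
open import Data.Vec.Properties using (lookup∘tabulate; []=⇒lookup; lookup⇒[]=)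
open import Function using (_⇔_; mk⇔; _∘_; flip; case_of_; Equivalence)
open import Function.Properties.Equivalence using (⇔-isEquivalence)
open import Induction.WellFounded using (Acc; acc)
open import Level using (0ℓ)
open import Relation.Binary using (IsEquivalence; Reflexive; Transitive)
open import Relation.Binary.PropositionalEquality using (_≡_; _≢_; _≗_; refl; sym; trans; cong; subst)
open import Relation.Nullary using (¬_; Dec; yes; no; does)
open import Relation.Nullary.Decidable
  using (map′; ¬?; _×-dec_; _⊎-dec_; dec-true; dec-false; decidable-stable)
open import Relation.Unary using (Pred; Decidable) renaming (_⊆_ to _⊆ᴾ_; _⊂_ to _⊂ᴾ_)

open Equivalence using (to; from)
module ⇔ {ℓ} = IsEquivalence (⇔-isEquivalence {ℓ})

private variable
  n : ℕ
  A B C D : Set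

-- Equivalences of propositions.

→-cong : A ⇔ B → C ⇔ D → (A → C) ⇔ (B → D)
→-cong e f = mk⇔ (λ g → to f ∘ g ∘ from e) (λ g → from f ∘ g ∘ to e)

¬-cong : A ⇔ B → (¬ A) ⇔ (¬ B)
¬-cong e = mk⇔ (_∘ from e) (_∘ to e)

-- The second components have to agree only once the first ones hold. Most conjuncts of the
-- extension formulas have their intended meaning only after `Well` has given `E ⊆ args`.
×-congᵈ : A ⇔ B → (A → C ⇔ D) → (A × C) ⇔ (B × D)
×-congᵈ e f = mk⇔ (λ (a , c) → to e a , to (f a) c) (λ (b , d) → from e b , from (f (from e b)) d)

does-true : (a? : Dec A) → (does a? ≡ true) ⇔ A
does-true (yes a) = mk⇔ (λ _ → a) (λ _ → refl)
does-true (no ¬a) = mk⇔ (λ ()) (λ a → ⊥-elim (¬a a))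

-- Valuations

module _ (v : Valuation n) (p : Prp n) (b : Bool) where

  update-same : (v [ p ≔ b ]) p ≡ b
  update-same = cong (if_then b else v p) (dec-true (p ≟ p) refl)

  update-other : ∀ {q} → p ≢ q → (v [ p ≔ b ]) q ≡ v q
  update-other {q} p≢q = cong (if_then b else v q) (dec-false (p ≟ q) p≢q)

  update-unique : ∀ {u : Valuation n} → u p ≡ b → (∀ {q} → p ≢ q → u q ≡ v q) → u ≗ v [ p ≔ b ]
  update-unique up u≗v q with p ≟ q
  ... | yes refl = trans up (sym update-same)
  ... | no  p≢q  = trans (u≗v p≢q) (sym (update-other p≢q))

update-cong : ∀ {v u : Valuation n} p b → v ≗ u → v [ p ≔ b ] ≗ u [ p ≔ b ]
update-cong {v = v} {u} p b v≗u =
  update-unique u p b (update-same v p b) (λ {q} p≢q → trans (update-other v p b p≢q) (v≗u q))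

mutual
  -- Valuations are functions compared pointwise, so truth and transitions must be shown to depend
  -- on them only up to `≗`. The three statements need one another: a box leads to its program, a
  -- test back to a formula, and `⁻¹` swaps the two ends of a transition.
  ⊨-resp : (φ : Formula n) {v u : Valuation n} → v ≗ u → v ⊨ φ → u ⊨ φ
  ⊨-resp (var p)   v≗u vp         = trans (sym (v≗u p)) vp
  ⊨-resp (~ φ)     v≗u ¬φ         = ¬φ ∘ ⊨-resp φ (sym ∘ v≗u)
  ⊨-resp (φ ∧ ψ)   v≗u (vφ , vψ)  = ⊨-resp φ v≗u vφ , ⊨-resp ψ v≗u vψ
  ⊨-resp ([ π ] φ) v≗u all w πuw  = all w (∥∥-respˡ π (sym ∘ v≗u) πuw)

  ∥∥-respˡ : (π : Program n) {v u w : Valuation n} → v ≗ u → ∥ π ∥ v w → ∥ π ∥ u w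
  ∥∥-respˡ (+̇ p)      v≗u w≗            = λ q → trans (w≗ q) (update-cong p true v≗u q)
  ∥∥-respˡ (-̇ p)      v≗u w≗            = λ q → trans (w≗ q) (update-cong p false v≗u q)
  ∥∥-respˡ (φ ¿)      v≗u (w≗v , vφ)    = (λ q → trans (w≗v q) (v≗u q)) , ⊨-resp φ v≗u vφ
  ∥∥-respˡ (π₁ ⨾ π₂)  v≗u (t , s₁ , s₂) = t , ∥∥-respˡ π₁ v≗u s₁ , s₂
  ∥∥-respˡ (π₁ ∪ᵖ π₂) v≗u (inj₁ s)      = inj₁ (∥∥-respˡ π₁ v≗u s)
  ∥∥-respˡ (π₁ ∪ᵖ π₂) v≗u (inj₂ s)      = inj₂ (∥∥-respˡ π₂ v≗u s)
  ∥∥-respˡ (π ⁻¹)     v≗u s             = ∥∥-respʳ π v≗u s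

  ∥∥-respʳ : (π : Program n) {v u w : Valuation n} → v ≗ u → ∥ π ∥ w v → ∥ π ∥ w u
  ∥∥-respʳ (+̇ p)      v≗u v≗            = λ q → trans (sym (v≗u q)) (v≗ q)
  ∥∥-respʳ (-̇ p)      v≗u v≗            = λ q → trans (sym (v≗u q)) (v≗ q)
  ∥∥-respʳ (φ ¿)      v≗u (v≗w , wφ)    = (λ q → trans (sym (v≗u q)) (v≗w q)) , wφ
  ∥∥-respʳ (π₁ ⨾ π₂)  v≗u (t , s₁ , s₂) = t , s₁ , ∥∥-respʳ π₂ v≗u s₂
  ∥∥-respʳ (π₁ ∪ᵖ π₂) v≗u (inj₁ s)      = inj₁ (∥∥-respʳ π₁ v≗u s)
  ∥∥-respʳ (π₁ ∪ᵖ π₂) v≗u (inj₂ s)      = inj₂ (∥∥-respʳ π₂ v≗u s)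
  ∥∥-respʳ (π ⁻¹)     v≗u s             = ∥∥-respˡ π v≗u s

Respects≗ : Pred (Valuation n) 0ℓ → Set
Respects≗ Q = ∀ {v u} → v ≗ u → Q v → Q u

-- Up to `≗` the only successor is the update itself, so a single test decides.
assign-search : (p : Prp n) (b : Bool) {Q : Pred (Valuation n) 0ℓ} → Respects≗ Q → Decidable Q →
                ∀ v → Dec (∃[ u ] (u ≗ v [ p ≔ b ] × Q u))
assign-search p b resp Q? v = map′
  (λ q → _ , (λ _ → refl) , q)
  (λ (u , u≗ , q) → resp u≗ q)
  (Q? (v [ p ≔ b ]))

-- A predecessor exists only if `v p` is already `b`. It then differs from `v` at most in `p`, which
-- leaves two candidates, one for each Boolean.
assign-search⁻ : (p : Prp n) (b : Bool) {Q : Pred (Valuation n) 0ℓ} → Respects≗ Q → Decidable Q →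
                 ∀ v → Dec (∃[ u ] (v ≗ u [ p ≔ b ] × Q u))
assign-search⁻ {n} p b {Q} resp Q? v with v p Bool.≟ b
... | no vp≢b = no λ (u , v≗ , _) → vp≢b (trans (v≗ p) (update-same u p b))
... | yes vp≡b = map′ to′ from′ (Q? (v [ p ≔ true ]) ⊎-dec Q? (v [ p ≔ false ]))
  where
  restore : ∀ c → v ≗ (v [ p ≔ c ]) [ p ≔ b ]
  restore c = update-unique (v [ p ≔ c ]) p b vp≡b (λ p≢q → sym (update-other v p c p≢q))

  to′ : Q (v [ p ≔ true ]) ⊎ Q (v [ p ≔ false ]) → ∃[ u ] (v ≗ u [ p ≔ b ] × Q u)
  to′ (inj₁ q) = _ , restore true , q
  to′ (inj₂ q) = _ , restore false , q

  is-update : ∀ {u c} → v ≗ u [ p ≔ b ] → u p ≡ c → u ≗ v [ p ≔ c ]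
  is-update {u} {c} v≗ up =
    update-unique v p c up (λ {q} p≢q → sym (trans (v≗ q) (update-other u p b p≢q)))

  from′ : ∃[ u ] (v ≗ u [ p ≔ b ] × Q u) → Q (v [ p ≔ true ]) ⊎ Q (v [ p ≔ false ])
  from′ (u , v≗ , q) with u p in up
  ... | true  = inj₁ (resp (is-update v≗ up) q)
  ... | false = inj₂ (resp (is-update v≗ up) q)

-- Valuations are infinite objects, but a program has only finitely many successors and
-- predecessors up to ≗; this makes ⟨ π ⟩ a constructive existential quantifier.
mutual
  infix 4 _⊨?_
  _⊨?_ : (v : Valuation n) (φ : Formula n) → Dec (v ⊨ φ)
  v ⊨? var p     = v p Bool.≟ true
  v ⊨? (~ φ)     = ¬? (v ⊨? φ)
  v ⊨? (φ ∧ ψ)   = (v ⊨? φ) ×-dec (v ⊨? ψ)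
  -- A box is decided by searching for a counterexample among the successors.
  v ⊨? ([ π ] φ) = map′
    (λ none u πvu → decidable-stable (u ⊨? φ) (λ ¬φ → none (u , πvu , ¬φ)))
    (λ all (u , πvu , ¬φ) → ¬φ (all u πvu))
    (¬? (search π (⊨-resp (~ φ)) (λ u → ¬? (u ⊨? φ)) v))

  search : (π : Program n) {Q : Pred (Valuation n) 0ℓ} → Respects≗ Q → Decidable Q →
           ∀ v → Dec (∃[ u ] (∥ π ∥ v u × Q u))
  search (+̇ p)      resp Q? v = assign-search p true resp Q? v
  search (-̇ p)      resp Q? v = assign-search p false resp Q? v
  search (φ ¿)      resp Q? v = map′
    (λ (vφ , q) → v , ((λ _ → refl) , vφ) , q)
    (λ (u , (u≗v , vφ) , q) → vφ , resp u≗v q)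
    ((v ⊨? φ) ×-dec Q? v)
  -- The searches nest: having a `π₂`-successor in `Q` is itself decidable and invariant under `≗`,
  -- so it can be the target of the search along `π₁`.
  search (π₁ ⨾ π₂)  resp Q? v = map′
    (λ (t , s₁ , u , s₂ , q) → u , (t , s₁ , s₂) , q)
    (λ (u , (t , s₁ , s₂) , q) → t , s₁ , u , s₂ , q)
    (search π₁ (λ v≗u (w , s , q) → w , ∥∥-respˡ π₂ v≗u s , q) (search π₂ resp Q?) v)
  search (π₁ ∪ᵖ π₂) resp Q? v = map′
    [ (λ (u , s , q) → u , inj₁ s , q) , (λ (u , s , q) → u , inj₂ s , q) ]′
    (λ { (u , inj₁ s , q) → inj₁ (u , s , q) ; (u , inj₂ s , q) → inj₂ (u , s , q) })
    (search π₁ resp Q? v ⊎-dec search π₂ resp Q? v)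
  search (π ⁻¹)     resp Q? v = search⁻ π resp Q? v

  search⁻ : (π : Program n) {Q : Pred (Valuation n) 0ℓ} → Respects≗ Q → Decidable Q →
            ∀ v → Dec (∃[ u ] (∥ π ∥ u v × Q u))
  search⁻ (+̇ p)      resp Q? v = assign-search⁻ p true resp Q? v
  search⁻ (-̇ p)      resp Q? v = assign-search⁻ p false resp Q? v
  search⁻ (φ ¿)      resp Q? v = map′
    (λ (vφ , q) → v , ((λ _ → refl) , vφ) , q)
    (λ (u , (v≗u , uφ) , q) → ⊨-resp φ (sym ∘ v≗u) uφ , resp (sym ∘ v≗u) q)
    ((v ⊨? φ) ×-dec Q? v)
  search⁻ (π₁ ⨾ π₂)  resp Q? v = map′
    (λ (t , s₂ , u , s₁ , q) → u , (t , s₁ , s₂) , q)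
    (λ (u , (t , s₁ , s₂) , q) → t , s₂ , u , s₁ , q)
    (search⁻ π₂ (λ v≗u (w , s , q) → w , ∥∥-respʳ π₁ v≗u s , q) (search⁻ π₁ resp Q?) v)
  search⁻ (π₁ ∪ᵖ π₂) resp Q? v = map′
    [ (λ (u , s , q) → u , inj₁ s , q) , (λ (u , s , q) → u , inj₂ s , q) ]′
    (λ { (u , inj₁ s , q) → inj₁ (u , s , q) ; (u , inj₂ s , q) → inj₂ (u , s , q) })
    (search⁻ π₁ resp Q? v ⊎-dec search⁻ π₂ resp Q? v)
  search⁻ (π ⁻¹)     resp Q? v = search π resp Q? v

-- Derived connectives

module _ (v : Valuation n) where

  -- The search decides whether a witness exists, which removes the double negation.
  ⊨-⟨⟩ : ∀ π φ → v ⊨ ⟨ π ⟩ φ ⇔ (∃[ u ] (∥ π ∥ v u × u ⊨ φ))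
  ⊨-⟨⟩ π φ = mk⇔
    (λ ¬none → decidable-stable (search π (⊨-resp φ) (_⊨? φ) v)
      (λ ¬some → ¬none (λ u s uφ → ¬some (u , s , uφ))))
    (λ (u , s , uφ) none → none u s uφ)

  ⊨-∨ : ∀ φ ψ → v ⊨ φ ∨ ψ ⇔ (v ⊨ φ ⊎ v ⊨ ψ)
  ⊨-∨ φ ψ = mk⇔
    (λ ¬¬ → decidable-stable ((v ⊨? φ) ⊎-dec (v ⊨? ψ)) (λ ¬⊎ → ¬¬ (¬⊎ ∘ inj₁ , ¬⊎ ∘ inj₂)))
    (λ { (inj₁ p) (¬p , _) → ¬p p ; (inj₂ q) (_ , ¬q) → ¬q q })

  ⊨-⟶ : ∀ φ ψ → v ⊨ φ ⟶ ψ ⇔ (v ⊨ φ → v ⊨ ψ)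
  ⊨-⟶ φ ψ = mk⇔
    (λ ¬× p → decidable-stable (v ⊨? ψ) (λ ¬q → ¬× (p , ¬q)))
    (λ f (p , ¬q) → ¬q (f p))

  ⊨-⟷ : ∀ φ ψ → v ⊨ φ ⟷ ψ ⇔ (v ⊨ φ ⇔ v ⊨ ψ)
  ⊨-⟷ φ ψ = mk⇔
    (λ (p , q) → mk⇔ (to (⊨-⟶ φ ψ) p) (to (⊨-⟶ ψ φ) q))
    (λ e → from (⊨-⟶ φ ψ) (to e) , from (⊨-⟶ ψ φ) (from e))

  ⊨-⋀ : (φ : Fin n → Formula n) → v ⊨ ⋀ φ ⇔ (∀ x → v ⊨ φ x)
  ⊨-⋀ φ = mk⇔ (λ vφ x → elim (allFin n) vφ (∈-allFin x)) (intro (allFin n))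
    where
    ⋀ᴸ : List (Fin n) → Formula n
    ⋀ᴸ = foldr (λ x ψ → φ x ∧ ψ) ⊤ᶠ

    elim : ∀ xs {x} → v ⊨ ⋀ᴸ xs → x ∈ᴸ xs → v ⊨ φ x
    elim (x ∷ xs) (vφ , _) (here refl) = vφ
    elim (x ∷ xs) (_ , vψ) (there x∈)  = elim xs vψ x∈

    intro : ∀ xs → (∀ x → v ⊨ φ x) → v ⊨ ⋀ᴸ xs
    intro []       all = λ (p , ¬p) → ¬p p
    intro (x ∷ xs) all = all x , intro xs all

  ⊨-⋁ : (φ : Fin n → Formula n) → v ⊨ ⋁ φ ⇔ (∃[ x ] v ⊨ φ x)
  ⊨-⋁ φ = mk⇔ (elim (allFin n)) (λ (x , vφ) → intro (allFin n) (∈-allFin x) vφ)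
    where
    ⋁ᴸ : List (Fin n) → Formula n
    ⋁ᴸ = foldr (λ x ψ → φ x ∨ ψ) ⊥ᶠ

    elim : ∀ xs → v ⊨ ⋁ᴸ xs → ∃[ x ] v ⊨ φ x
    elim []       (p , ¬p) = ⊥-elim (¬p p)
    elim (x ∷ xs) vφ with to (⊨-∨ (φ x) (⋁ᴸ xs)) vφ
    ... | inj₁ p = x , p
    ... | inj₂ q = elim xs q

    intro : ∀ xs {x} → x ∈ᴸ xs → v ⊨ φ x → v ⊨ ⋁ᴸ xs
    intro (x ∷ xs) (here refl) vφ = from (⊨-∨ (φ x) (⋁ᴸ xs)) (inj₁ vφ)
    intro (x ∷ xs) (there x∈)  vφ = from (⊨-∨ (φ x) (⋁ᴸ xs)) (inj₂ (intro xs x∈ vφ))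

  ⊨-[⨾] : ∀ π₁ π₂ φ → v ⊨ [ π₁ ⨾ π₂ ] φ ⇔ v ⊨ [ π₁ ] [ π₂ ] φ
  ⊨-[⨾] π₁ π₂ φ = mk⇔ (λ all t s₁ u s₂ → all u (t , s₁ , s₂)) (λ all u (t , s₁ , s₂) → all t s₁ u s₂)

  -- Both sides are negated universal statements, so the negations rearrange without any search for
  -- a witness.
  ⊨-⟨⨾⟩ : ∀ π₁ π₂ φ → v ⊨ ⟨ π₁ ⨾ π₂ ⟩ φ ⇔ v ⊨ ⟨ π₁ ⟩ ⟨ π₂ ⟩ φ
  ⊨-⟨⨾⟩ π₁ π₂ φ = mk⇔
    (λ ¬none none → ¬none (λ u (t , s₁ , s₂) uφ → none t s₁ (λ none′ → none′ u s₂ uφ)))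
    (λ ¬none none → ¬none (λ t s₁ ¬none′ → ¬none′ (λ u s₂ uφ → none u (t , s₁ , s₂) uφ)))

-- Programs assigning variables one after the other

-- T relates the possible old values of a variable to the possible new ones.
Assigns : (Bool → Bool → Set) → (Prp n → Program n) → Set
Assigns T f = ∀ p v u → ∥ f p ∥ v u ⇔ (∃[ b ] (T (v p) b × u ≗ v [ p ≔ b ]))

-- The joint effect of a sequence of assignments, described variable by variable; the order of `P`
-- and repetitions in it do not matter.
Modifies : (Bool → Bool → Set) → List (Prp n) → Valuation n → Valuation n → Set
Modifies T P v u = ∀ p → u p ≡ v p ⊎ (p ∈ᴸ P × T (v p) (u p))

skip-intro : {v u : Valuation n} → u ≗ v → ∥ skip ∥ v u
skip-intro u≗v = u≗v , λ (p , ¬p) → ¬p p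

-- Transitivity combines the assignments made to a variable that `P` lists several times.
-- Conversely, the target is reached by giving each listed variable its final value in turn;
-- reflexivity covers those that keep their value.
∥Seq∥ : {T : Bool → Bool → Set} → Reflexive T → Transitive T →
        {f : Prp n → Program n} → Assigns T f →
        ∀ P {v u} → ∥ Seq (map f P) ∥ v u ⇔ Modifies T P v u
∥Seq∥ {n} {T} T-refl T-trans {f} assigns P = mk⇔ (sound P) (complete P)
  where
  sound : ∀ P {v u} → ∥ Seq (map f P) ∥ v u → Modifies T P v u
  sound []      (u≗v , _)   p = inj₁ (u≗v p)
  sound (q ∷ P) {v} {u} (t , s , s′) p with to (assigns q v t) s | sound P s′ p | q ≟ p
  ... | b , Tvb , t≗ | inj₁ ut | yes refl =
    inj₂ (here refl , subst (T (v q)) (sym (trans ut (trans (t≗ q) (update-same v q b)))) Tvb)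
  ... | b , Tvb , t≗ | inj₂ (_ , Ttu) | yes refl =
    inj₂ (here refl , T-trans (subst (T (v q)) (sym (trans (t≗ q) (update-same v q b))) Tvb) Ttu)
  ... | b , _ , t≗ | inj₁ ut | no q≢p = inj₁ (trans ut (trans (t≗ p) (update-other v q b q≢p)))
  ... | b , _ , t≗ | inj₂ (p∈ , Ttu) | no q≢p =
    inj₂ (there p∈ , subst (λ c → T c (u p)) (trans (t≗ p) (update-other v q b q≢p)) Ttu)

  complete : ∀ P {v u} → Modifies T P v u → ∥ Seq (map f P) ∥ v u
  complete [] {v} {u} m = skip-intro λ p → [ (λ e → e) , (λ ()) ]′ (m p)
  complete (q ∷ P) {v} {u} m = t , from (assigns q v t) (u q , Tq , λ _ → refl) , complete P m′
    where
    -- Once `q` has its final value, the remaining assignments may treat it as unchanged, whether or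
    -- not it occurs again in `P`.
    t = v [ q ≔ u q ]

    Tq : T (v q) (u q)
    Tq = [ (λ e → subst (T (v q)) (sym e) T-refl) , proj₂ ]′ (m q)

    m′ : Modifies T P t u
    m′ p with q ≟ p | m p
    ... | yes refl | _ = inj₁ (sym (update-same v q (u q)))
    ... | no q≢p | inj₁ e = inj₁ (trans e (sym (update-other v q (u q) q≢p)))
    ... | no q≢p | inj₂ (here refl , _) = ⊥-elim (q≢p refl)
    ... | no q≢p | inj₂ (there p∈ , Tvu) =
      inj₂ (p∈ , subst (λ c → T c (u p)) (sym (update-other v q (u q) q≢p)) Tvu)

update-trivial : ∀ (v : Valuation n) p → v ≗ v [ p ≔ v p ]
update-trivial v p = update-unique v p (v p) refl (λ _ → refl)

Unrestricted : Bool → Bool → Set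
Unrestricted _ _ = ⊤

∥vary∥ : ∀ P {v u : Valuation n} → ∥ vary P ∥ v u ⇔ Modifies Unrestricted P v u
∥vary∥ = ∥Seq∥ tt (λ _ _ → tt) λ p v u → mk⇔
  (λ { (inj₁ u≗) → true , tt , u≗ ; (inj₂ u≗) → false , tt , u≗ })
  (λ { (true , _ , u≗) → inj₁ u≗ ; (false , _ , u≗) → inj₂ u≗ })

-- Here `skip` counts as assigning the old value, so each factor assigns some `b` with `v p ≤ b`.
∥mkTrueSome∥ : ∀ P {v u : Valuation n} → ∥ mkTrueSome P ∥ v u ⇔ Modifies _≤_ P v u
∥mkTrueSome∥ {n} = ∥Seq∥ Bool.≤-refl Bool.≤-trans λ p v u → mk⇔
  (λ { (inj₁ u≗) → true , Bool.≤-maximum (v p) , u≗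
     ; (inj₂ (u≗v , _)) → v p , Bool.≤-refl , λ q → trans (u≗v q) (update-trivial v p q) })
  (complete p v u)
  where
  complete : ∀ p (v u : Valuation n) → ∃[ b ] (v p ≤ b × u ≗ v [ p ≔ b ]) → ∥ +̇ p ∪ᵖ skip ∥ v u
  complete p v u (true , _ , u≗) = inj₁ u≗
  complete p v u (false , vp≤ , u≗) with v p in vp | vp≤
  -- Only `v p` equal to `false` is below `false`, and then the assignment changes nothing.
  ... | false | b≤b = inj₂ (skip-intro λ q → trans (u≗ q)
    (trans (cong (λ b → (v [ p ≔ b ]) q) (sym vp)) (sym (update-trivial v p q))))

∥mkFalseSome∥ : ∀ P {v u : Valuation n} → ∥ mkFalseSome P ∥ v u ⇔ Modifies (flip _≤_) P v u
∥mkFalseSome∥ {n} = ∥Seq∥ Bool.≤-refl (flip Bool.≤-trans) λ p v u → mk⇔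
  (λ { (inj₁ u≗) → false , Bool.≤-minimum (v p) , u≗
     ; (inj₂ (u≗v , _)) → v p , Bool.≤-refl , λ q → trans (u≗v q) (update-trivial v p q) })
  (complete p v u)
  where
  complete : ∀ p (v u : Valuation n) → ∃[ b ] (b ≤ v p × u ≗ v [ p ≔ b ]) → ∥ -̇ p ∪ᵖ skip ∥ v u
  complete p v u (false , _ , u≗) = inj₁ u≗
  complete p v u (true , ≤vp , u≗) with v p in vp | ≤vp
  ... | true | b≤b = inj₂ (skip-intro λ q → trans (u≗ q)
    (trans (cong (λ b → (v [ p ≔ b ]) q) (sym vp)) (sym (update-trivial v p q))))

-- Choices, concatenations and the copying program.

module _ {X : Set} (f : X → Program n) {v u : Valuation n} where

  Choice-sound : ∀ x xs → ∥ Choice (map f (x ∷ xs)) ∥ v u → ∃[ y ] (y ∈ᴸ x ∷ xs × ∥ f y ∥ v u)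
  Choice-sound x []       s        = x , here refl , s
  Choice-sound x (y ∷ xs) (inj₁ s) = x , here refl , s
  Choice-sound x (y ∷ xs) (inj₂ s) =
    let (z , z∈ , s′) = Choice-sound y xs s in z , there z∈ , s′

  Choice-complete : ∀ {x} xs → x ∈ᴸ xs → ∥ f x ∥ v u → ∥ Choice (map f xs) ∥ v u
  Choice-complete (x ∷ [])         (here refl) s = s
  Choice-complete (x ∷ _ ∷ _)      (here refl) s = inj₁ s
  Choice-complete (x ∷ xs@(_ ∷ _)) (there x∈)  s = inj₂ (Choice-complete xs x∈ s)

-- A non-empty list, since the empty choice is skip.
∥mkTrueOne∥ : ∀ q P {v u : Valuation n} →
              ∥ mkTrueOne (q ∷ P) ∥ v u ⇔ (∃[ p ] (p ∈ᴸ q ∷ P × v p ≢ true × u ≗ v [ p ≔ true ]))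
∥mkTrueOne∥ {n} q P = mk⇔
  (λ s → let (p , p∈ , t , (t≗v , ¬vp) , u≗) = Choice-sound f q P s in
         p , p∈ , ¬vp , λ x → trans (u≗ x) (update-cong p true t≗v x))
  (λ (p , p∈ , ¬vp , u≗) → Choice-complete f (q ∷ P) p∈ (_ , ((λ _ → refl) , ¬vp) , u≗))
  where
  f : Prp n → Program n
  f p = (~ var p) ¿ ⨾ +̇ p

∥mkFalseOne∥ : ∀ q P {v u : Valuation n} →
               ∥ mkFalseOne (q ∷ P) ∥ v u ⇔ (∃[ p ] (p ∈ᴸ q ∷ P × v p ≡ true × u ≗ v [ p ≔ false ]))
∥mkFalseOne∥ {n} q P = mk⇔
  (λ s → let (p , p∈ , t , (t≗v , vp) , u≗) = Choice-sound f q P s in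
         p , p∈ , vp , λ x → trans (u≗ x) (update-cong p false t≗v x))
  (λ (p , p∈ , vp , u≗) → Choice-complete f (q ∷ P) p∈ (_ , ((λ _ → refl) , vp) , u≗))
  where
  f : Prp n → Program n
  f p = var p ¿ ⨾ -̇ p

Seq-++ : ∀ πs πs′ {v u : Valuation n} → ∥ Seq (πs ++ πs′) ∥ v u ⇔ ∥ Seq πs ⨾ Seq πs′ ∥ v u
Seq-++ []       πs′ = mk⇔ (λ s → _ , skip-intro (λ _ → refl) , s)
                          (λ (t , (t≗v , _) , s) → ∥∥-respˡ (Seq πs′) t≗v s)
Seq-++ (π ∷ πs) πs′ = mk⇔
  (λ (t , s , s′) → let (w , s₁ , s₂) = to (Seq-++ πs πs′) s′ in w , (t , s , s₁) , s₂)
  (λ (w , (t , s , s₁) , s₂) → t , s , from (Seq-++ πs πs′) (w , s₁ , s₂))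

-- This merges the two halves of `makeComp`, so that one instance of `Modifies` describes the whole
-- program.
mkTrueSome-++ : ∀ P Q {v u : Valuation n} →
                ∥ mkTrueSome (P ++ Q) ∥ v u ⇔ ∥ mkTrueSome P ⨾ mkTrueSome Q ∥ v u
mkTrueSome-++ {n} P Q {v} {u} =
  subst (λ πs → ∥ Seq πs ∥ v u ⇔ ∥ mkTrueSome P ⨾ mkTrueSome Q ∥ v u)
    (sym (map-++ f P Q)) (Seq-++ (map f P) (map f Q))
  where
  f : Prp n → Program n
  f p = +̇ p ∪ᵖ skip

copyOne : Fin n → Program n
copyOne x = (var (inn x) ¿ ⨾ +̇ inn′ x) ∪ᵖ ((~ var (inn x)) ¿ ⨾ -̇ inn′ x)

copyOne-sound : ∀ x {v u : Valuation n} → ∥ copyOne x ∥ v u → u ≗ v [ inn′ x ≔ v (inn x) ]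
copyOne-sound x {v} (inj₁ (t , (t≗v , vx) , u≗)) q = trans (u≗ q)
  (trans (update-cong (inn′ x) true t≗v q) (cong (λ b → (v [ inn′ x ≔ b ]) q) (sym vx)))
copyOne-sound x {v} (inj₂ (t , (t≗v , ¬vx) , u≗)) q = trans (u≗ q)
  (trans (update-cong (inn′ x) false t≗v q) (cong (λ b → (v [ inn′ x ≔ b ]) q) (sym (Bool.¬-not ¬vx))))

copyOne-total : ∀ x (v : Valuation n) → ∃[ u ] ∥ copyOne x ∥ v u
copyOne-total x v with v (inn x) Bool.≟ true
... | yes vx = _ , inj₁ (v , ((λ _ → refl) , vx) , λ _ → refl)
... | no ¬vx = _ , inj₂ (v , ((λ _ → refl) , ¬vx) , λ _ → refl)

record Copied (v u : Valuation n) : Set where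
  field
    copied    : ∀ x → u (inn′ x) ≡ v (inn x)
    unchanged : ∀ {p} → (∀ x → inn′ x ≢ p) → u p ≡ v p

-- A box over `copyIN` would hold vacuously if there were no execution; extracting information from
-- such a box requires one.
copyIN-total : ∀ (v : Valuation n) → ∃[ u ] ∥ copyIN ∥ v u
copyIN-total {n} = go (allFin n)
  where
  go : ∀ xs v → ∃[ u ] ∥ Seq (map copyOne xs) ∥ v u
  go []       v = v , skip-intro (λ _ → refl)
  go (x ∷ xs) v = let (t , s) = copyOne-total x v ; (u , s′) = go xs t in u , t , s , s′

copyIN-sound : {v u : Valuation n} → ∥ copyIN ∥ v u → Copied v u
copyIN-sound {n} s = record
  { copied    = λ x → copied (allFin n) s (inj₁ (∈-allFin x))
  ; unchanged = unchanged (allFin n) s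
  }
  where
  unchanged : ∀ xs {v u : Valuation n} → ∥ Seq (map copyOne xs) ∥ v u →
              ∀ {p} → (∀ x → inn′ x ≢ p) → u p ≡ v p
  unchanged []       (u≗v , _)      _  = u≗v _
  unchanged (x ∷ xs) {v} (t , s , s′) {p} p≢ = trans (unchanged xs s′ p≢)
    (trans (copyOne-sound x s p) (update-other v (inn′ x) _ (p≢ x)))

  -- The invariant: either `x` is still to be processed, or its copy is already right. Variables
  -- `inn` never change, so processing `x` again does no harm.
  copied : ∀ xs {v u : Valuation n} → ∥ Seq (map copyOne xs) ∥ v u →
           ∀ {x} → x ∈ᴸ xs ⊎ v (inn′ x) ≡ v (inn x) → u (inn′ x) ≡ v (inn x)
  copied []       (u≗v , _)    (inj₂ e) = trans (u≗v _) e
  copied (y ∷ xs) {v} (t , s , s′) {x} h = trans (copied xs s′ h′) tx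
    where
    t≗ = copyOne-sound y s

    tx : t (inn x) ≡ v (inn x)
    tx = trans (t≗ (inn x)) (update-other v (inn′ y) (v (inn y)) (λ ()))

    h′ : x ∈ᴸ xs ⊎ t (inn′ x) ≡ t (inn x)
    h′ with inn′ y ≟ inn′ x
    ... | yes refl = inj₂ (trans (t≗ (inn′ y)) (trans (update-same v (inn′ y) (v (inn y))) (sym tx)))
    ... | no y≢x   = Sum.map
      (λ { (here refl) → ⊥-elim (y≢x refl) ; (there x∈) → x∈ })
      (λ e → trans (t≗ (inn′ x)) (trans (update-other v (inn′ y) _ y≢x) (trans e (sym tx))))
      h

-- Frameworks and sets of arguments as valuations

-- A valuation may contain r x y for arguments x, y it does not contain; these are no attacks.
record Framework (F : AF n) (v : Valuation n) : Set where
  open AF F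
  field
    args⇔ : ∀ x → x ∈ args ⇔ v (aw x) ≡ true
    att⇔  : ∀ x y → Att att x y ⇔ (v (aw x) ≡ true × v (aw y) ≡ true × v (r x y) ≡ true)

-- The parameter `i` is `inn` for the current set and `inn′` for the copy kept by `copyIN`.
Labels : (Fin n → Prp n) → Subset n → Valuation n → Set
Labels i E v = ∀ x → x ∈ E ⇔ v (i x) ≡ true

≡⇒⇔ : {b c : Bool} → b ≡ c → b ≡ true ⇔ c ≡ true
≡⇒⇔ b≡c = mk⇔ (trans (sym b≡c)) (trans b≡c)

Framework-resp : {F : AF n} {v u : Valuation n} → (∀ x → v (aw x) ≡ u (aw x)) →
                 (∀ x y → v (r x y) ≡ u (r x y)) → Framework F v → Framework F u
Framework-resp aw≡ r≡ fr = record
  { args⇔ = λ x → ⇔.trans (args⇔ x) (≡⇒⇔ (aw≡ x))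
  ; att⇔  = λ x y → ⇔.trans (att⇔ x y) (≡⇒⇔ (aw≡ x) ×-⇔ (≡⇒⇔ (aw≡ y) ×-⇔ ≡⇒⇔ (r≡ x y)))
  }
  where open Framework fr

∈-lookup⇔ : ∀ (E : Subset n) x → x ∈ E ⇔ lookup E x ≡ true
∈-lookup⇔ E x = mk⇔ []=⇒lookup (lookup⇒[]= x E)

∈-tabulate⇔ : ∀ (f : Fin n → Bool) x → x ∈ tabulate f ⇔ f x ≡ true
∈-tabulate⇔ f x = ⇔.trans (∈-lookup⇔ (tabulate f) x) (≡⇒⇔ (lookup∘tabulate f x))

labelled : (Fin n → Prp n) → Valuation n → Subset n
labelled i v = tabulate (v ∘ i)

labelled-Labels : ∀ i (v : Valuation n) → Labels i (labelled i v) v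
labelled-Labels i v = ∈-tabulate⇔ (v ∘ i)

relabel : Subset n → Valuation n → Valuation n
relabel E v (inn x) = lookup E x
relabel E v p       = v p

relabel-Labels : ∀ (E : Subset n) v → Labels inn E (relabel E v)
relabel-Labels E v = ∈-lookup⇔ E

-- A concrete encoding of `F`, at which formulas can be evaluated in order to decide properties of
-- sets.
frame : AF n → Valuation n
frame F (aw x)  = lookup (AF.args F) x
frame F (r x y) = lookup (AF.att F x) y
frame F _       = false

frame-Framework : (F : AF n) → Framework F (frame F)
frame-Framework F = record
  { args⇔ = ∈-lookup⇔ args
  ; att⇔  = λ x y → mk⇔
      (λ a → to (∈-lookup⇔ args x) (proj₁ (att-on a)) , to (∈-lookup⇔ args y) (proj₂ (att-on a)) ,
             to (∈-lookup⇔ (att x) y) a)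
      (λ (_ , _ , rxy) → from (∈-lookup⇔ (att x) y) rxy)
  }
  where open AF F

-- The Boolean formulas at an encoding of a framework and a set.

module Encoding {F : AF n} {v : Valuation n} (fr : Framework F v) where
  open AF F
  open Framework fr

  attackedBy : (Fin n → Prp n) → Fin n → Fin n → Formula n
  attackedBy i x y = var (i y) ∧ var (r y x)

  module _ {i : Fin n → Prp n} {E : Subset n} (la : Labels i E v) where

    -- A variable `r y x` stands for an attack only if both ends are present in `v`; the two
    -- membership hypotheses guarantee this.
    ⊨-attacked : E ⊆ args → ∀ {x} → x ∈ args → v ⊨ ⋁ (attackedBy i x) ⇔ (F ⁺) E x
    ⊨-attacked E⊆ {x} x∈ = mk⇔
      (λ s → let (y , iy , ryx) = to (⊨-⋁ v (attackedBy i x)) s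
                 y∈E = from (la y) iy
             in x∈ , y , y∈E , from (att⇔ y x) (to (args⇔ y) (E⊆ y∈E) , to (args⇔ x) x∈ , ryx))
      (λ (_ , y , y∈E , a) → from (⊨-⋁ v (attackedBy i x)) (y , to (la y) y∈E , proj₂ (proj₂ (to (att⇔ y x) a))))

    -- The conjunct `aw x` supplies the `x ∈ args` under which being attacked has its intended
    -- meaning.
    ⊨-Rg : E ⊆ args → ∀ x → v ⊨ Rg i x ⇔ (F ⊕) E x
    ⊨-Rg E⊆ x = ⇔.trans (⊨-∨ v (var (i x)) (var (aw x) ∧ ⋁ (attackedBy i x)))
      (⇔.sym (la x) ⊎-⇔ mk⇔
        (λ (awx , s) → to (⊨-attacked E⊆ (from (args⇔ x) awx)) s)
        (λ a@(x∈ , _) → to (args⇔ x) x∈ , from (⊨-attacked E⊆ x∈) a))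

  module _ {E : Subset n} (la : Labels inn E v) where

    ⊨-Defended : E ⊆ args → ∀ {x} → x ∈ args → v ⊨ Defended x ⇔ Defends F E x
    ⊨-Defended E⊆ {x} x∈ = mk⇔
      (λ s {y} y∈ a → to (⊨-attacked la E⊆ y∈)
        (to (⊨-⟶ v (var (aw y) ∧ var (r y x)) (⋁ (attackedBy inn y))) (to (⊨-⋀ v _) s y)
          (to (args⇔ y) y∈ , proj₂ (proj₂ (to (att⇔ y x) a)))))
      (λ d → from (⊨-⋀ v _) λ y →
        from (⊨-⟶ v (var (aw y) ∧ var (r y x)) (⋁ (attackedBy inn y))) λ (awy , ryx) →
          from (⊨-attacked la E⊆ (from (args⇔ y) awy))
            (d (from (args⇔ y) awy) (from (att⇔ y x) (awy , to (args⇔ x) x∈ , ryx))))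

    ⊨-Well : v ⊨ Well ⇔ E ⊆ args
    ⊨-Well = mk⇔
      (λ s {x} x∈E → from (args⇔ x)
        (to (⊨-⟶ v (var (inn x)) (var (aw x))) (to (⊨-⋀ v _) s x) (to (la x) x∈E)))
      (λ E⊆ → from (⊨-⋀ v _) λ x → from (⊨-⟶ v (var (inn x)) (var (aw x))) λ ix →
        to (args⇔ x) (E⊆ (from (la x) ix)))

    ⊨-ConFree : v ⊨ ConFree ⇔ ConflictFree F E
    ⊨-ConFree = ×-congᵈ ⊨-Well λ well → let E⊆ = to ⊨-Well well in mk⇔
      (λ s {x} x∈E (_ , y , y∈E , a) → to (⊨-⋀ v _) (to (⊨-⋀ v _) s y) x
        (to (la y) y∈E , to (la x) x∈E , proj₂ (proj₂ (to (att⇔ y x) a))))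
      (λ cf → from (⊨-⋀ v _) λ x → from (⊨-⋀ v _) λ y (ix , iy , rxy) →
        let x∈E = from (la x) ix ; y∈E = from (la y) iy in
        cf y∈E (E⊆ y∈E , x , x∈E ,
                from (att⇔ x y) (to (args⇔ x) (E⊆ x∈E) , to (args⇔ y) (E⊆ y∈E) , rxy)))

    ⊨-Admissible : v ⊨ Admissible ⇔ AdmissibleSet F E
    ⊨-Admissible = ×-congᵈ ⊨-ConFree defended
      where
      defended : v ⊨ ConFree →
                 v ⊨ (⋀ λ x → var (inn x) ⟶ Defended x) ⇔ (∀ {x} → x ∈ E → Defends F E x)
      defended cf = let E⊆ = proj₁ (to ⊨-ConFree cf) in mk⇔
        (λ s {x} x∈E {y} → to (⊨-Defended E⊆ (E⊆ x∈E))
          (to (⊨-⟶ v (var (inn x)) (Defended x)) (to (⊨-⋀ v _) s x) (to (la x) x∈E)) {y})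
        (λ d → from (⊨-⋀ v _) λ x → from (⊨-⟶ v (var (inn x)) (Defended x)) λ ix →
          let x∈E = from (la x) ix in from (⊨-Defended E⊆ (E⊆ x∈E)) (d x∈E))

    ⊨-Complete : v ⊨ Complete ⇔ CompleteExt F E
    ⊨-Complete = ×-congᵈ ⊨-ConFree λ cf → let E⊆ = proj₁ (to ⊨-ConFree cf) in mk⇔
      (λ s {x} x∈ → ⇔.trans (la x) (⇔.trans
        (to (⊨-⟷ v (var (inn x)) (Defended x))
          (to (⊨-⟶ v (var (aw x)) (var (inn x) ⟷ Defended x)) (to (⊨-⋀ v _) s x) (to (args⇔ x) x∈)))
        (⊨-Defended E⊆ x∈)))
      (λ c → from (⊨-⋀ v _) λ x → from (⊨-⟶ v (var (aw x)) (var (inn x) ⟷ Defended x)) λ awx →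
        let x∈ = from (args⇔ x) awx in
        from (⊨-⟷ v (var (inn x)) (Defended x))
          (⇔.trans (⇔.sym (la x)) (⇔.trans (c x∈) (⇔.sym (⊨-Defended E⊆ x∈)))))

    ⊨-Stable : v ⊨ Stable ⇔ StableExt F E
    ⊨-Stable = mk⇔ sound complete
      where
      sound : v ⊨ Stable → StableExt F E
      sound (well , s) =
        (E⊆ , λ {x} x∈E a →
          to (in⇔ (E⊆ x∈E)) (to (la x) x∈E) (from (⊨-attacked la E⊆ (E⊆ x∈E)) a)) ,
        -- An unattacked `x` would have to be in `E`; decidability of the formula turns this into an
        -- actual attacker.
        λ {x} x∈ x∉E → to (⊨-attacked la E⊆ x∈)
          (decidable-stable (v ⊨? ⋁ (attackedBy inn x)) (x∉E ∘ from (la x) ∘ from (in⇔ x∈)))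
        where
        E⊆ : E ⊆ args
        E⊆ = to ⊨-Well well

        in⇔ : ∀ {x} → x ∈ args → v (inn x) ≡ true ⇔ (¬ v ⊨ ⋁ (attackedBy inn x))
        in⇔ {x} x∈ = to (⊨-⟷ v (var (inn x)) (~ ⋁ (attackedBy inn x)))
          (to (⊨-⟶ v (var (aw x)) (var (inn x) ⟷ ~ ⋁ (attackedBy inn x))) (to (⊨-⋀ v _) s x) (to (args⇔ x) x∈))

      complete : StableExt F E → v ⊨ Stable
      complete ((E⊆ , cf) , out) = from ⊨-Well E⊆ , from (⊨-⋀ v _) λ x →
        from (⊨-⟶ v (var (aw x)) (var (inn x) ⟷ ~ ⋁ (attackedBy inn x))) λ awx →
          let x∈ = from (args⇔ x) awx in
          from (⊨-⟷ v (var (inn x)) (~ ⋁ (attackedBy inn x))) (mk⇔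
            (λ ix att → cf (from (la x) ix) (to (⊨-attacked la E⊆ x∈) att))
            (λ ¬att → to (la x) (decidable-stable (x ∈? E) λ x∉E →
              ¬att (from (⊨-attacked la E⊆ x∈) (out x∈ x∉E)))))

-- Modal formulas over the sets of arguments

Modifies-IN-unchanged : ∀ T {v u : Valuation n} {p} → Modifies T IN v u → (∀ x → inn x ≢ p) → u p ≡ v p
Modifies-IN-unchanged T {p = p} m inn≢p with m p
... | inj₁ e = e
... | inj₂ (p∈ , _) = let (x , _ , p≡) = ∈-map⁻ inn p∈ in ⊥-elim (inn≢p x (sym p≡))

Modifies-≤ : ∀ {P} {v u : Valuation n} → Modifies _≤_ P v u → ∀ p → v p ≤ u p
Modifies-≤ m p = [ Bool.≤-reflexive ∘ sym , proj₂ ]′ (m p)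

Modifies-≥ : ∀ {P} {v u : Valuation n} → Modifies (flip _≤_) P v u → ∀ p → u p ≤ v p
Modifies-≥ m p = [ Bool.≤-reflexive , proj₂ ]′ (m p)

≤⇒true : {b c : Bool} → b ≤ c → b ≡ true → c ≡ true
≤⇒true b≤b e = e

true⇒≤ : {b c : Bool} → (b ≡ true → c ≡ true) → b ≤ c
true⇒≤ {false} h = Bool.≤-minimum _
true⇒≤ {true}  h = Bool.≤-reflexive (sym (h refl))

-- Here `t` is the valuation reached after a first step that changed only variables `inn`, or `v`
-- itself. The second step has to account for the variables `inn` alone.
relabel-modifies : ∀ T (E : Subset n) (v : Valuation n) {t} → (∀ {p} → (∀ x → inn x ≢ p) → t p ≡ v p) →
                   (∀ x → T (t (inn x)) (lookup E x)) → Modifies T IN t (relabel E v)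
relabel-modifies T E v t≡ h (aw x)    = inj₁ (sym (t≡ (λ _ ())))
relabel-modifies T E v t≡ h (inn x)   = inj₂ (∈-map⁺ inn (∈-allFin x) , h x)
relabel-modifies T E v t≡ h (inn′ x)  = inj₁ (sym (t≡ (λ _ ())))
relabel-modifies T E v t≡ h (r x y)   = inj₁ (sym (t≡ (λ _ ())))
relabel-modifies T E v t≡ h (other k) = inj₁ (sym (t≡ (λ _ ())))

relabel-vary : (E : Subset n) (v : Valuation n) → ∥ vary IN ∥ v (relabel E v)
relabel-vary E v = from (∥vary∥ IN) (relabel-modifies Unrestricted E v (λ _ → refl) (λ _ → tt))

Framework-modifies : ∀ T {F : AF n} {v u} → Modifies T IN v u → Framework F v → Framework F u
Framework-modifies T m = Framework-resp (λ x → sym (Modifies-IN-unchanged T m (λ _ ())))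
                                        (λ x y → sym (Modifies-IN-unchanged T m (λ _ ())))

Framework-relabel : ∀ {F : AF n} {v} E → Framework F v → Framework F (relabel E v)
Framework-relabel E = Framework-resp (λ _ → refl) (λ _ _ → refl)

-- Correctness is demanded at all encodings of `F` at once, because a modality moves to other
-- valuations encoding `F`, where the inner formula has to be interpreted again.
record Characterises (F : AF n) (φ : Formula n) (P : Pred (Subset n) 0ℓ) : Set where
  field
    correct : ∀ {v E} → Framework F v → Labels inn E v → v ⊨ φ ⇔ P E

open Characterises

-- Model checking serves as the decision procedure for `P`.
decidable : ∀ {F : AF n} {φ P} → Characterises F φ P → Decidable P
decidable {F = F} {φ} ch E = map′ (to e) (from e) (relabel E (frame F) ⊨? φ)
  where e = correct ch (Framework-relabel E (frame-Framework F)) (relabel-Labels E (frame F))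

module _ {F : AF n} {φ : Formula n} {P : Pred (Subset n) 0ℓ} (ch : Characterises F φ P) where

  makeExtBy-sound : ∀ {v u} → Framework F v → ∥ makeExtBy φ ∥ v u → ∃[ E ] (P E × Labels inn E u)
  makeExtBy-sound {v} {u} fr (t , s , u≗t , tφ) =
    labelled inn u ,
    to (correct ch (Framework-resp (λ x → sym (u≗t (aw x))) (λ x y → sym (u≗t (r x y)))
             (Framework-modifies Unrestricted (to (∥vary∥ IN) s) fr))
           (labelled-Labels inn u))
       (⊨-resp φ (sym ∘ u≗t) tφ) ,
    labelled-Labels inn u

  makeExtBy-complete : ∀ {v E} → Framework F v → P E → ∥ makeExtBy φ ∥ v (relabel E v)
  makeExtBy-complete {v} {E} fr PE =
    relabel E v , relabel-vary E v , (λ _ → refl) ,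
    from (correct ch (Framework-relabel E fr) (relabel-Labels E v)) PE

  ⊨-[makeExtBy] : ∀ {v} → Framework F v → ∀ x → v ⊨ [ makeExtBy φ ] var (inn x) ⇔ (∀ E → P E → x ∈ E)
  ⊨-[makeExtBy] fr x = mk⇔
    (λ all E PE → from (∈-lookup⇔ E x) (all _ (makeExtBy-complete fr PE)))
    (λ all u s → let (E , PE , la) = makeExtBy-sound fr s in to (la x) (all E PE))

  ⊨-⟨makeExtBy⟩ : ∀ {v} → Framework F v → ∀ x → v ⊨ ⟨ makeExtBy φ ⟩ var (inn x) ⇔ (∃[ E ] (P E × x ∈ E))
  ⊨-⟨makeExtBy⟩ {v} fr x = ⇔.trans (⊨-⟨⟩ v (makeExtBy φ) (var (inn x))) (mk⇔
    (λ (u , s , ux) → let (E , PE , la) = makeExtBy-sound fr s in E , PE , from (la x) ux)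
    (λ (E , PE , x∈E) → relabel E v , makeExtBy-complete fr PE , to (∈-lookup⇔ E x) x∈E))

  -- With admissibility for `Q`, this gives ideal sets when `P` is preferred and eager sets when `P`
  -- is semi-stable. The box overwrites the variables `inn`, so membership of `x` in `E` is tested
  -- before entering it.
  characterises-unanimous : ∀ {ψ Q} → Characterises F ψ Q →
    Characterises F (ψ ∧ (⋀ λ x → var (inn x) ⟶ [ makeExtBy φ ] var (inn x)))
                    (λ E → Q E × (∀ E′ → P E′ → E ⊆ E′))
  characterises-unanimous chψ .correct {v} fr la = correct chψ fr la ×-⇔ mk⇔
    (λ s E′ PE′ {x} x∈E → to (⊨-[makeExtBy] fr x)
      (to (⊨-⟶ v (var (inn x)) ([ makeExtBy φ ] var (inn x))) (to (⊨-⋀ v _) s x) (to (la x) x∈E))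
      E′ PE′)
    (λ all → from (⊨-⋀ v _) λ x → from (⊨-⟶ v (var (inn x)) ([ makeExtBy φ ] var (inn x))) λ ix →
      from (⊨-[makeExtBy] fr x) (λ E′ PE′ → all E′ PE′ (from (la x) ix)))

  -- The copy preserves `E` in `inn′` while `inn` runs over all `E′` satisfying `P`. The implication
  -- then says that a range including that of `E` is also included in it, so no inclusion is strict.
  characterises-maximalRange : (∀ {E} → P E → E ⊆ AF.args F) →
    Characterises F (φ ∧ [ copyIN ⨾ vary IN ⨾ φ ¿ ] (IncludesCp ⟶ IncludedInCp)) (MaximalRange F P)
  characterises-maximalRange P⊆ .correct {v} {E} fr la = ×-congᵈ (correct ch fr la) λ vφ → mk⇔ (sound vφ) (complete vφ)
    where
    ranges : ∀ {u E′} → Framework F u → Labels inn′ E u → Labels inn E′ u →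
             E ⊆ AF.args F → E′ ⊆ AF.args F →
             -- Strict inclusion is an inclusion together with the failure of its converse, and `⟶`
             -- unfolds to a negated conjunction of the same shape.
             u ⊨ IncludesCp ⟶ IncludedInCp ⇔ (¬ ((F ⊕) E ⊂ᴾ (F ⊕) E′))
    ranges {u} {E′} fru la′ lau E⊆ E′⊆ = ¬-cong (includesCp ×-⇔ ¬-cong includedInCp)
      where
      open Encoding fru

      step : ∀ x → u ⊨ Rg inn′ x ⟶ Rg inn x ⇔ ((F ⊕) E x → (F ⊕) E′ x)
      step x = ⇔.trans (⊨-⟶ u (Rg inn′ x) (Rg inn x)) (→-cong (⊨-Rg la′ E⊆ x) (⊨-Rg lau E′⊆ x))

      step⁻ : ∀ x → u ⊨ Rg inn x ⟶ Rg inn′ x ⇔ ((F ⊕) E′ x → (F ⊕) E x)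
      step⁻ x = ⇔.trans (⊨-⟶ u (Rg inn x) (Rg inn′ x)) (→-cong (⊨-Rg lau E′⊆ x) (⊨-Rg la′ E⊆ x))

      includesCp : u ⊨ IncludesCp ⇔ (F ⊕) E ⊆ᴾ (F ⊕) E′
      includesCp = mk⇔ (λ s {x} → to (step x) (to (⊨-⋀ u _) s x))
                       (λ h → from (⊨-⋀ u _) λ x → from (step x) h)

      includedInCp : u ⊨ IncludedInCp ⇔ (F ⊕) E′ ⊆ᴾ (F ⊕) E
      includedInCp = mk⇔ (λ s {x} → to (step⁻ x) (to (⊨-⋀ u _) s x))
                         (λ h → from (⊨-⋀ u _) λ x → from (step⁻ x) h)

    module _ {t} (s : ∥ copyIN ∥ v t) where
      open Copied (copyIN-sound {v = v} {t} s)

      fr-copied : Framework F t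
      fr-copied = Framework-resp (λ x → sym (unchanged (λ _ ()))) (λ x y → sym (unchanged (λ _ ()))) fr

      la-copied : Labels inn′ E t
      la-copied x = ⇔.trans (la x) (≡⇒⇔ (sym (copied x)))

    sound : v ⊨ φ → v ⊨ [ copyIN ⨾ vary IN ⨾ φ ¿ ] (IncludesCp ⟶ IncludedInCp) →
            ∀ E′ → P E′ → ¬ ((F ⊕) E ⊂ᴾ (F ⊕) E′)
    sound vφ all E′ PE′ = let (t , s) = copyIN-total v in
      to (ranges (Framework-relabel E′ (fr-copied s)) (la-copied s) (relabel-Labels E′ t)
                 (P⊆ (to (correct ch fr la) vφ)) (P⊆ PE′))
         (all (relabel E′ t) (t , s , makeExtBy-complete (fr-copied s) PE′))

    complete : v ⊨ φ → (∀ E′ → P E′ → ¬ ((F ⊕) E ⊂ᴾ (F ⊕) E′)) →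
               v ⊨ [ copyIN ⨾ vary IN ⨾ φ ¿ ] (IncludesCp ⟶ IncludedInCp)
    complete vφ max u (t , s , w , s′ , u≗w , wφ) =
      let m = to (∥vary∥ IN) s′
          fru = Framework-resp (λ x → sym (u≗w (aw x))) (λ x y → sym (u≗w (r x y)))
                  (Framework-modifies Unrestricted m (fr-copied s))
          lau = labelled-Labels inn u
          PE′ = to (correct ch fru lau) (⊨-resp φ (sym ∘ u≗w) wφ)
          la′ = λ x → ⇔.trans (la-copied s x)
                  (≡⇒⇔ (sym (trans (u≗w (inn′ x)) (Modifies-IN-unchanged Unrestricted m (λ _ ())))))
      in from (ranges fru la′ lau (P⊆ (to (correct ch fr la) vφ)) (P⊆ PE′)) (max _ PE′)

-- Here n must be positive: over an empty universe mkTrueOne IN and mkFalseOne IN are skip.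
module _ {m : ℕ} where
  private N = suc m

  ∥mkTrueOne-IN∥ : (v u : Valuation N) →
                   ∥ mkTrueOne IN ∥ v u ⇔ (∃[ x ] (v (inn x) ≢ true × u ≗ v [ inn x ≔ true ]))
  ∥mkTrueOne-IN∥ v u = mk⇔
    (λ s → let (p , p∈ , rest) = to one s ; (x , _ , p≡) = ∈-map⁻ inn p∈ in
           x , subst (λ p → v p ≢ true × u ≗ v [ p ≔ true ]) p≡ rest)
    (λ (x , rest) → from one (inn x , ∈-map⁺ inn (∈-allFin x) , rest))
    where one = ∥mkTrueOne∥ (inn zero) (map inn (List.tabulate suc)) {v} {u}

  ∥mkFalseOne-IN∥ : (v u : Valuation N) →
                    ∥ mkFalseOne IN ∥ v u ⇔ (∃[ x ] (v (inn x) ≡ true × u ≗ v [ inn x ≔ false ]))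
  ∥mkFalseOne-IN∥ v u = mk⇔
    (λ s → let (p , p∈ , rest) = to one s ; (x , _ , p≡) = ∈-map⁻ inn p∈ in
           x , subst (λ p → v p ≡ true × u ≗ v [ p ≔ false ]) p≡ rest)
    (λ (x , rest) → from one (inn x , ∈-map⁺ inn (∈-allFin x) , rest))
    where one = ∥mkFalseOne∥ (inn zero) (map inn (List.tabulate suc)) {v} {u}

  module _ {v t : Valuation N} {E E′ : Subset N} (la : Labels inn E v) (la′ : Labels inn E′ t) where

    mkTrueOne-⊂ : ∥ mkTrueOne IN ∥ v t → E ⊂ E′
    mkTrueOne-⊂ s with to (∥mkTrueOne-IN∥ v t) s
    ... | x , ¬vx , t≗ = (λ {y} y∈E → from (la′ y) (kept y (to (la y) y∈E)))
                       , x , from (la′ x) (trans (t≗ (inn x)) (update-same v (inn x) true)) , ¬vx ∘ to (la x)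
      where
      kept : ∀ y → v (inn y) ≡ true → t (inn y) ≡ true
      kept y vy with inn x ≟ inn y
      ... | yes refl = ⊥-elim (¬vx vy)
      ... | no x≢y   = trans (t≗ (inn y)) (trans (update-other v (inn x) true x≢y) vy)

    mkFalseOne-⊂ : ∥ mkFalseOne IN ∥ v t → E′ ⊂ E
    mkFalseOne-⊂ s with to (∥mkFalseOne-IN∥ v t) s
    ... | x , vx , t≗ = (λ {y} y∈E′ → from (la y) (kept y (to (la′ y) y∈E′)))
                      , x , from (la x) vx
                      , (λ x∈E′ → Bool.not-¬ (trans (t≗ (inn x)) (update-same v (inn x) false))
                                    (to (la′ x) x∈E′))
      where
      kept : ∀ y → t (inn y) ≡ true → v (inn y) ≡ true
      kept y ty with inn x ≟ inn y
      ... | yes refl = vx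
      ... | no x≢y   = trans (sym (trans (t≗ (inn y)) (update-other v (inn x) false x≢y))) ty

  module _ {v : Valuation N} {E E′ : Subset N} (la : Labels inn E v) where

    private
      set : Fin N → Bool → Valuation N
      set x b = v [ inn x ≔ b ]

    update-⊆ : ∀ {x} → E ⊆ E′ → x ∈ E′ → ∀ y → set x true (inn y) ≡ true → y ∈ E′
    update-⊆ {x} E⊆ x∈ y e with inn x ≟ inn y
    ... | yes refl = x∈
    ... | no x≢y   = E⊆ (from (la y) (trans (sym (update-other v (inn x) true x≢y)) e))

    update-⊇ : ∀ {x} → E′ ⊆ E → x ∉ E′ → ∀ y → y ∈ E′ → set x false (inn y) ≡ true
    update-⊇ {x} ⊆E x∉ y y∈ with inn x ≟ inn y
    ... | yes refl = ⊥-elim (x∉ y∈)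
    ... | no x≢y   = trans (update-other v (inn x) false x≢y) (to (la y) (⊆E y∈))

    -- `mkTrueOne` adds the witness of strictness, and `mkTrueSome` adds whatever else `E′` has.
    grow : E ⊂ E′ → ∥ mkTrueOne IN ⨾ mkTrueSome IN ∥ v (relabel E′ v)
    grow (E⊆ , x , x∈ , x∉) =
      set x true , from (∥mkTrueOne-IN∥ v _) (x , x∉ ∘ from (la x) , λ _ → refl) ,
      from (∥mkTrueSome∥ IN) (relabel-modifies _≤_ E′ v (λ ≢p → update-other v (inn x) true (≢p x))
        (λ y → true⇒≤ (to (∈-lookup⇔ E′ y) ∘ update-⊆ E⊆ x∈ y)))

    shrink : E′ ⊂ E → ∥ mkFalseOne IN ⨾ mkFalseSome IN ∥ v (relabel E′ v)
    shrink (⊆E , x , x∈ , x∉) =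
      set x false , from (∥mkFalseOne-IN∥ v _) (x , to (la x) x∈ , λ _ → refl) ,
      from (∥mkFalseSome∥ IN) (relabel-modifies (flip _≤_) E′ v (λ ≢p → update-other v (inn x) false (≢p x))
        (λ y → true⇒≤ (update-⊇ ⊆E x∉ y ∘ from (∈-lookup⇔ E′ y))))

  mkTrueOne-modifies : {v u : Valuation N} → ∥ mkTrueOne IN ∥ v u → Modifies Unrestricted IN v u
  mkTrueOne-modifies {v} {u} s q with to (∥mkTrueOne-IN∥ v u) s
  ... | x , _ , u≗ with inn x ≟ q
  ... | yes refl = inj₂ (∈-map⁺ inn (∈-allFin x) , tt)
  ... | no x≢q   = inj₁ (trans (u≗ q) (update-other v (inn x) true x≢q))

  mkFalseOne-modifies : {v u : Valuation N} → ∥ mkFalseOne IN ∥ v u → Modifies Unrestricted IN v u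
  mkFalseOne-modifies {v} {u} s q with to (∥mkFalseOne-IN∥ v u) s
  ... | x , _ , u≗ with inn x ≟ q
  ... | yes refl = inj₂ (∈-map⁺ inn (∈-allFin x) , tt)
  ... | no x≢q   = inj₁ (trans (u≗ q) (update-other v (inn x) false x≢q))

  module _ {F : AF N} {φ : Formula N} {P : Pred (Subset N) 0ℓ} (ch : Characterises F φ P) where

    -- By `grow` every proper superset of `E` is reached. Conversely, the first step of the program
    -- enlarges the set strictly and the second never removes anything.
    characterises-maximal : Characterises F (φ ∧ [ mkTrueOne IN ⨾ mkTrueSome IN ] (~ φ)) (Maximal F P)
    characterises-maximal .correct {v} {E} fr la = correct ch fr la ×-⇔ mk⇔
      (λ none E′ PE′ E⊂E′ → none (relabel E′ v) (grow la E⊂E′)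
        (from (correct ch (Framework-relabel E′ fr) (relabel-Labels E′ v)) PE′))
      (λ max u (t , s , s′) uφ →
        let m   = to (∥mkTrueSome∥ IN) s′
            fru = Framework-modifies _≤_ m (Framework-modifies Unrestricted (mkTrueOne-modifies s) fr)
            lau = labelled-Labels inn u
            lat = labelled-Labels inn t
        in max _ (to (correct ch fru lau) uφ) (⊂-⊆-trans (mkTrueOne-⊂ {v = v} la lat s)
             (λ {x} → from (lau x) ∘ ≤⇒true (Modifies-≤ m (inn x)) ∘ to (lat x))))

    characterises-minimal : Characterises F (φ ∧ [ mkFalseOne IN ⨾ mkFalseSome IN ] (~ φ)) (Minimal F P)
    characterises-minimal .correct {v} {E} fr la = correct ch fr la ×-⇔ mk⇔
      (λ none E′ PE′ E′⊂E → none (relabel E′ v) (shrink la E′⊂E)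
        (from (correct ch (Framework-relabel E′ fr) (relabel-Labels E′ v)) PE′))
      (λ min u (t , s , s′) uφ →
        let m   = to (∥mkFalseSome∥ IN) s′
            fru = Framework-modifies (flip _≤_) m (Framework-modifies Unrestricted (mkFalseOne-modifies s) fr)
            lau = labelled-Labels inn u
            lat = labelled-Labels inn t
        in min _ (to (correct ch fru lau) uφ) (⊆-⊂-trans
             (λ {x} → from (lat x) ∘ ≤⇒true (Modifies-≥ m (inn x)) ∘ to (lau x))
             (mkFalseOne-⊂ {v = v} la lat s)))

    -- For a property inherited by subsets, maximality is tested by adding single arguments.
    characterises-maximal-hereditary : (∀ {E E′} → E ⊆ E′ → P E′ → P E) →
      Characterises F (φ ∧ [ mkTrueOne IN ] (~ φ)) (Maximal F P)
    characterises-maximal-hereditary hereditary .correct {v} {E} fr la = correct ch fr la ×-⇔ mk⇔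
      (λ { none E′ PE′ (E⊆ , x , x∈ , x∉) →
        -- Adding to `E` only the witness `x` of strictness stays within `E′`, so `P` is inherited
        -- from there.
        let s = from (∥mkTrueOne-IN∥ v _) (x , x∉ ∘ from (la x) , λ _ → refl)
            t = v [ inn x ≔ true ]
            lat = labelled-Labels inn t
        in none t s (from (correct ch (Framework-modifies Unrestricted (mkTrueOne-modifies s) fr) lat)
             (hereditary (λ {y} → update-⊆ {v = v} la E⊆ x∈ y ∘ to (lat y)) PE′)) })
      (λ max u s uφ → let lau = labelled-Labels inn u in
        max _ (to (correct ch (Framework-modifies Unrestricted (mkTrueOne-modifies s) fr) lau) uφ)
              (mkTrueOne-⊂ {v = v} la lau s))

-- Admissible and complete sets

module _ {F : AF n} where
  open AF F

  conflictFree-hereditary : ∀ {E E′} → E ⊆ E′ → ConflictFree F E′ → ConflictFree F E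
  conflictFree-hereditary E⊆E′ (E′⊆ , cf) =
    ⊆-trans E⊆E′ E′⊆ , λ x∈E (x∈ , y , y∈E , a) → cf (E⊆E′ x∈E) (x∈ , y , E⊆E′ y∈E , a)

  complete⇒admissible : ∀ {E} → CompleteExt F E → AdmissibleSet F E
  complete⇒admissible (cf@(E⊆ , _) , c) = cf , λ a∈E → to (c (E⊆ a∈E)) a∈E

  -- Dung's fundamental lemma.
  admissible-insert : ∀ {E a} → AdmissibleSet F E → a ∈ args → Defends F E a → AdmissibleSet F (E ∪ ⁅ a ⁆)
  admissible-insert {E} {a} ((E⊆ , cf) , d) a∈ da = (E′⊆ , cf′) , λ x∈ y∈ att → weaken (d′ x∈ y∈ att)
    where
    E′ = E ∪ ⁅ a ⁆

    E⊆E′ : E ⊆ E′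
    E⊆E′ = p⊆p∪q ⁅ a ⁆

    member : ∀ {x} → x ∈ E′ → x ∈ E ⊎ x ≡ a
    member = Sum.map₂ (x∈⁅y⁆⇒x≡y a) ∘ x∈p∪q⁻ E ⁅ a ⁆

    E′⊆ : E′ ⊆ args
    E′⊆ x∈ with member x∈
    ... | inj₁ x∈E  = E⊆ x∈E
    ... | inj₂ refl = a∈

    weaken : ∀ {x} → (F ⁺) E x → (F ⁺) E′ x
    weaken (x∈ , y , y∈E , att) = x∈ , y , E⊆E′ y∈E , att

    d′ : ∀ {x} → x ∈ E′ → Defends F E x
    d′ x∈ with member x∈
    ... | inj₁ x∈E  = d x∈E
    ... | inj₂ refl = da

    -- If some `z` in `E` attacked `y`, then `E`, which defends `y`, would attack its own member
    -- `z`.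
    unattacked : ∀ {y} → y ∈ E′ → ¬ (F ⁺) E y
    unattacked y∈ (_ , z , z∈E , att) = cf z∈E (d′ y∈ (E⊆ z∈E) att)

    -- An attack inside `E′` is answered by `E` attacking the attacker, which also lies in `E′`.
    cf′ : ∀ {x} → x ∈ E′ → ¬ (F ⁺) E′ x
    cf′ x∈ (_ , y , y∈ , att) = unattacked y∈ (d′ x∈ (E′⊆ y∈) att)

  -- A defended argument outside `E` could be inserted, against maximality.
  maximalAdmissible⇒complete : ∀ {E} → Maximal F (AdmissibleSet F) E → CompleteExt F E
  maximalAdmissible⇒complete {E} (adm@(cf , d) , max) = cf , λ {a} a∈ → mk⇔ d λ da →
    decidable-stable (a ∈? E) λ a∉E →
      max _ (admissible-insert adm a∈ da) (p⊆p∪q ⁅ a ⁆ , a , q⊆p∪q E ⁅ a ⁆ (x∈⁅x⁆ a) , a∉E)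

  -- Proper supersets satisfying `P` are searched for exhaustively; the climb ends because `⊃` is
  -- well-founded on subsets of a finite set.
  extend-to-maximal : ∀ {P} → Decidable P → ∀ E → P E → ∃[ E′ ] (E ⊆ E′ × Maximal F P E′)
  extend-to-maximal {P} P? E = go E (⊃-wellFounded E)
    where
    go : ∀ E → Acc _⊃_ E → P E → ∃[ E′ ] (E ⊆ E′ × Maximal F P E′)
    go E (acc rec) PE with anySubset? (λ E′ → P? E′ ×-dec (E ⊂? E′))
    ... | no none = E , ⊆-refl , PE , λ E′ PE′ E⊂E′ → none (E′ , PE′ , E⊂E′)
    ... | yes (E′ , PE′ , E⊂E′) = let (E″ , E′⊆E″ , max) = go E′ (rec E⊂E′) PE′ in
      E″ , ⊆-trans (proj₁ E⊂E′) E′⊆E″ , max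

  -- An admissible proper superset of a preferred `E` extends to a maximal admissible set; that set
  -- is complete and contradicts the maximality of `E` among complete sets.
  maximalAdmissible⇔preferred : Decidable (AdmissibleSet F) → ∀ {E} →
                                Maximal F (AdmissibleSet F) E ⇔ PreferredExt F E
  maximalAdmissible⇔preferred adm? = mk⇔
    (λ m@(_ , max) → maximalAdmissible⇒complete m , λ E′ c → max E′ (complete⇒admissible c))
    (λ (c , max) → complete⇒admissible c , λ E′ adm E⊂E′ →
      let (E″ , E′⊆E″ , m) = extend-to-maximal adm? E′ adm in
      max E″ (maximalAdmissible⇒complete m) (⊂-⊆-trans E⊂E′ E′⊆E″))

-- Correctness of the formulas for the nine semantics.

module _ {m : ℕ} (F : AF (suc m)) where

  characterises-Complete : Characterises F Complete (CompleteExt F)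
  characterises-Complete .correct fr la = Encoding.⊨-Complete fr la

  characterises-ConFree : Characterises F ConFree (ConflictFree F)
  characterises-ConFree .correct fr la = Encoding.⊨-ConFree fr la

  characterises-Admissible : Characterises F Admissible (AdmissibleSet F)
  characterises-Admissible .correct fr la = Encoding.⊨-Admissible fr la

  characterises-Preferred : Characterises F Preferred (PreferredExt F)
  characterises-Preferred .correct fr la = ⇔.trans
    (correct (characterises-maximal characterises-Admissible) fr la)
    (maximalAdmissible⇔preferred {F = F} (decidable characterises-Admissible))

  characterises-SemiStable : Characterises F SemiStable (SemiStableExt F)
  characterises-SemiStable = characterises-maximalRange characterises-Complete (proj₁ ∘ proj₁)

  characterises-Extension : ∀ σ → Characterises F φ[ σ ] (Extension σ F)
  characterises-Extension st  .correct fr la = Encoding.⊨-Stable fr la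
  characterises-Extension co  = characterises-Complete
  characterises-Extension gr  = characterises-minimal characterises-Complete
  characterises-Extension pr  = characterises-Preferred
  characterises-Extension se  = characterises-SemiStable
  characterises-Extension id  = characterises-maximal
    (characterises-unanimous characterises-Preferred characterises-Admissible)
  characterises-Extension ea  = characterises-maximal
    (characterises-unanimous characterises-SemiStable characterises-Admissible)
  characterises-Extension na  =
    characterises-maximal-hereditary characterises-ConFree (conflictFree-hereditary {F = F})
  characterises-Extension stg = characterises-maximalRange characterises-ConFree proj₁

-- Completions

∈-AW⁺ : {A : Subset n} {x : Fin n} → x ∈ A → aw x ∈ᴸ AW A
∈-AW⁺ {A = A} x∈ = ∈-map⁺ aw (∈-filter⁺ (_∈? A) (∈-allFin _) x∈)

∈-AW⁻ : (A : Subset n) {p : Prp n} → p ∈ᴸ AW A → ∃[ x ] (x ∈ A × p ≡ aw x)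
∈-AW⁻ A p∈ = let (x , x∈ , p≡) = ∈-map⁻ aw p∈ in
  x , proj₂ (∈-filter⁻ (_∈? A) {xs = allFin _} x∈) , p≡

∈-ATT⁺ : {R : Attacks n} {x y : Fin n} → Att R x y → r x y ∈ᴸ ATT R
∈-ATT⁺ {R = R} {x} {y} a = ∈-map⁺ (uncurry r)
  (∈-filter⁺ (λ (x , y) → y ∈? R x) (∈-cartesianProduct⁺ (∈-allFin x) (∈-allFin y)) a)

∈-ATT⁻ : (R : Attacks n) {p : Prp n} → p ∈ᴸ ATT R → ∃[ x ] ∃[ y ] (Att R x y × p ≡ r x y)
∈-ATT⁻ R p∈ = let ((x , y) , xy∈ , p≡) = ∈-map⁻ (uncurry r) p∈ in
  x , y , proj₂ (∈-filter⁻ (λ (x , y) → y ∈? R x) {xs = cartesianProduct (allFin _) (allFin _)} xy∈) , p≡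

aw-member : ∀ (A : Subset n) R {x} → aw x ∈ᴸ AW A ++ ATT R ⇔ x ∈ A
aw-member A R = mk⇔
  ([ (λ p∈ → case ∈-AW⁻ A p∈ of λ { (_ , x∈ , refl) → x∈ })
   , (λ p∈ → case ∈-ATT⁻ R p∈ of λ { (_ , _ , _ , ()) }) ]′ ∘ ∈-++⁻ (AW A))
  (∈-++⁺ˡ ∘ ∈-AW⁺)

r-member : ∀ (A : Subset n) R {x y} → r x y ∈ᴸ AW A ++ ATT R ⇔ Att R x y
r-member A R = mk⇔
  ([ (λ p∈ → case ∈-AW⁻ A p∈ of λ { (_ , _ , ()) })
   , (λ p∈ → case ∈-ATT⁻ R p∈ of λ { (_ , _ , a , refl) → a }) ]′ ∘ ∈-++⁻ (AW A))
  (∈-++⁺ʳ (AW A) ∘ ∈-ATT⁺ {R = R})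

module _ (I : IAF n) where
  open IAF I

  initial-aw : ∀ x → initial I (aw x) ≡ true ⇔ x ∈ Aᶠ
  initial-aw x = ⇔.trans (does-true (mem? _≟_ (aw x) (AW Aᶠ ++ ATT Rᶠ))) (aw-member Aᶠ Rᶠ)

  initial-r : ∀ x y → initial I (r x y) ≡ true ⇔ Att Rᶠ x y
  initial-r x y = ⇔.trans (does-true (mem? _≟_ (r x y) (AW Aᶠ ++ ATT Rᶠ))) (r-member Aᶠ Rᶠ)

  ∥makeComp∥ : ∀ {v} → ∥ makeComp I ∥ (initial I) v ⇔ Modifies _≤_ (AW A? ++ ATT R?) (initial I) v
  ∥makeComp∥ = ⇔.trans (⇔.sym (mkTrueSome-++ (AW A?) (ATT R?))) (∥mkTrueSome∥ (AW A? ++ ATT R?))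

  -- Variables only become true, which gives the lower bounds of a completion, and only those of
  -- `A?` and `R?` do so, which gives the upper bounds. Attacks are restricted to the arguments
  -- present.
  makeComp-sound : ∀ {v} → ∥ makeComp I ∥ (initial I) v → ∃[ F ] (IsCompletion I F × Framework F v)
  makeComp-sound {v} s = F , completion , record { args⇔ = ∈-tabulate⇔ (v ∘ aw) ; att⇔ = att⇔ }
    where
    m : Modifies _≤_ (AW A? ++ ATT R?) (initial I) v
    m = to ∥makeComp∥ s

    present? : ∀ x y → Dec (v (aw x) ≡ true × v (aw y) ≡ true × v (r x y) ≡ true)
    present? x y = (v (aw x) Bool.≟ true) ×-dec ((v (aw y) Bool.≟ true) ×-dec (v (r x y) Bool.≟ true))

    Aᵛ : Subset _
    Aᵛ = tabulate (v ∘ aw)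

    Rᵛ : Attacks _
    Rᵛ x = tabulate (λ y → does (present? x y))

    att⇔ : ∀ x y → Att Rᵛ x y ⇔ (v (aw x) ≡ true × v (aw y) ≡ true × v (r x y) ≡ true)
    att⇔ x y = ⇔.trans (∈-tabulate⇔ (λ y → does (present? x y)) y) (does-true (present? x y))

    args⇔ : ∀ x → x ∈ Aᵛ ⇔ v (aw x) ≡ true
    args⇔ = ∈-tabulate⇔ (v ∘ aw)

    on : ∀ {x y} → Att Rᵛ x y → x ∈ Aᵛ × y ∈ Aᵛ
    on {x} {y} a = let (ax , ay , _) = to (att⇔ x y) a in from (args⇔ x) ax , from (args⇔ y) ay

    F : AF _
    F = record { args = Aᵛ ; att = Rᵛ ; att-on = on }

    completion : IsCompletion I F
    completion = record
      { args-lower = λ {x} x∈ → from (args⇔ x) (≤⇒true (Modifies-≤ m (aw x)) (from (initial-aw x) x∈))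
      ; args-upper = λ {x} x∈ → x∈p∪q⁺ (Sum.map
          (λ e → to (initial-aw x) (trans (sym e) (to (args⇔ x) x∈)))
          (to (aw-member A? R?) ∘ proj₁)
          (m (aw x)))
      ; att-lower = λ {x} {y} (a , x∈ , y∈) → from (att⇔ x y)
          (to (args⇔ x) x∈ , to (args⇔ y) y∈ , ≤⇒true (Modifies-≤ m (r x y)) (from (initial-r x y) a))
      ; att-upper = λ {x} {y} a → x∈p∪q⁺ (Sum.map
          (λ e → to (initial-r x y) (trans (sym e) (proj₂ (proj₂ (to (att⇔ x y) a)))))
          (to (r-member A? R?) ∘ proj₁)
          (m (r x y))) , on a
      }

  makeComp-complete : ∀ {F} → IsCompletion I F → ∃[ v ] (∥ makeComp I ∥ (initial I) v × Framework F v)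
  makeComp-complete {F} c = v , from ∥makeComp∥ m , fr
    where
    open AF F
    open IsCompletion c

    -- Attacks of Rᶠ between arguments missing from the completion cannot be switched off.
    v : Valuation _
    v (aw x)  = lookup args x
    v (r x y) = initial I (r x y) ∨ᵇ lookup (att x) y
    v p       = initial I p

    att-true : ∀ {x y} → Att att x y → v (r x y) ≡ true
    att-true {x} {y} a =
      trans (cong (initial I (r x y) ∨ᵇ_) (to (∈-lookup⇔ (att x) y) a)) (Bool.∨-zeroʳ _)

    m : Modifies _≤_ (AW A? ++ ATT R?) (initial I) v
    m (aw x) with x ∈? args
    ... | yes x∈ = let vx = to (∈-lookup⇔ args x) x∈ in Sum.map
      (λ x∈ᶠ → trans vx (sym (from (initial-aw x) x∈ᶠ)))
      (λ x∈? → from (aw-member A? R?) x∈? , true⇒≤ (λ _ → vx))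
      (x∈p∪q⁻ Aᶠ A? (args-upper x∈))
    -- Since `Aᶠ ⊆ args`, a missing argument is false in the initial valuation as well.
    ... | no x∉ = inj₁ (trans (Bool.¬-not (x∉ ∘ from (∈-lookup⇔ args x)))
      (sym (Bool.¬-not (x∉ ∘ args-lower ∘ to (initial-aw x)))))
    m (r x y) with y ∈? att x
    ... | yes a = let vxy = att-true a in Sum.map
      (λ aᶠ → trans vxy (sym (from (initial-r x y) aᶠ)))
      (λ a? → from (r-member A? R?) a? , true⇒≤ (λ _ → vxy))
      (x∈p∪q⁻ (Rᶠ x) (R? x) (proj₁ (att-upper a)))
    ... | no ¬a = inj₁ (trans
      (cong (initial I (r x y) ∨ᵇ_) (Bool.¬-not (¬a ∘ from (∈-lookup⇔ (att x) y)))) (Bool.∨-identityʳ _))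
    m (inn x)   = inj₁ refl
    m (inn′ x)  = inj₁ refl
    m (other k) = inj₁ refl

    fr : Framework F v
    fr = record
      { args⇔ = ∈-lookup⇔ args
      ; att⇔  = λ x y → mk⇔
          (λ a → let (x∈ , y∈) = att-on a in
            to (∈-lookup⇔ args x) x∈ , to (∈-lookup⇔ args y) y∈ ,
            att-true a)
          (λ (ax , ay , vxy) →
            -- An initially true `r x y` comes from `Rᶠ`, and between present arguments such an
            -- attack belongs to every completion.
            [ (λ e → att-lower (to (initial-r x y) e , from (∈-lookup⇔ args x) ax , from (∈-lookup⇔ args y) ay))
            , from (∈-lookup⇔ (att x) y) ]′ (∨-true (initial I (r x y)) vxy))
      }
      where
      ∨-true : ∀ b {c} → b ∨ᵇ c ≡ true → b ≡ true ⊎ c ≡ true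
      ∨-true true  _ = inj₁ refl
      ∨-true false e = inj₂ e

  module _ (ψ : Formula n) {Ψ : AF n → Set} (ψ⇔Ψ : ∀ {F v} → Framework F v → v ⊨ ψ ⇔ Ψ F) where

    -- The truth of `ψ` depends only on the framework encoded, so ranging over executions of
    -- `makeComp` amounts to ranging over completions.
    ⊨-[makeComp] : initial I ⊨ [ makeComp I ] ψ ⇔ (∀ F → IsCompletion I F → Ψ F)
    ⊨-[makeComp] = mk⇔
      (λ all F c → let (v , s , fr) = makeComp-complete c in to (ψ⇔Ψ fr) (all v s))
      (λ all v s → let (F , c , fr) = makeComp-sound s in from (ψ⇔Ψ fr) (all F c))

    ⊨-⟨makeComp⟩ : initial I ⊨ ⟨ makeComp I ⟩ ψ ⇔ (∃[ F ] (IsCompletion I F × Ψ F))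
    ⊨-⟨makeComp⟩ = ⇔.trans (⊨-⟨⟩ (initial I) (makeComp I) ψ) (mk⇔
      (λ (v , s , vψ) → let (F , c , fr) = makeComp-sound s in F , c , to (ψ⇔Ψ fr) vψ)
      (λ (F , c , Fψ) → let (v , s , fr) = makeComp-complete c in v , s , from (ψ⇔Ψ fr) Fψ))

proposition3 : (n : ℕ) .{{_ : NonZero n}} (I : IAF n) (σ : Semantics) (a : Fin n) → a ∈ IAF.Aᶠ I →
    (NSA σ I a ⇔ (initial I ⊨ [ makeComp I ⨾ makeExt σ ] var (inn a)))
    × (NCA σ I a ⇔ (initial I ⊨ [ makeComp I ] ⟨ makeExt σ ⟩ var (inn a)))
    × (PCA σ I a ⇔ (initial I ⊨ ⟨ makeComp I ⨾ makeExt σ ⟩ var (inn a)))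
    × (PSA σ I a ⇔ (initial I ⊨ ⟨ makeComp I ⟩ [ makeExt σ ] var (inn a)))
-- The universe is non-empty, so `mkTrueOne IN` and `mkFalseOne IN` really change a variable.
proposition3 (suc m) I σ a _ =
    ⇔.sym (⇔.trans
      (⊨-[⨾] (initial I) (makeComp I) (makeExt σ) (var (inn a)))
      (⊨-[makeComp] I ([ makeExt σ ] var (inn a)) sceptical))
  , ⇔.sym (⊨-[makeComp] I (⟨ makeExt σ ⟩ var (inn a)) credulous)
  , ⇔.sym (⇔.trans
      (⊨-⟨⨾⟩ (initial I) (makeComp I) (makeExt σ) (var (inn a)))
      (⊨-⟨makeComp⟩ I (⟨ makeExt σ ⟩ var (inn a)) credulous))
  , ⇔.sym (⊨-⟨makeComp⟩ I ([ makeExt σ ] var (inn a)) sceptical)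
  where
  sceptical : ∀ {F v} → Framework F v →
              v ⊨ [ makeExt σ ] var (inn a) ⇔ (∀ E → Extension σ F E → a ∈ E)
  sceptical {F} fr = ⊨-[makeExtBy] (characterises-Extension F σ) fr a

  credulous : ∀ {F v} → Framework F v →
              v ⊨ ⟨ makeExt σ ⟩ var (inn a) ⇔ (∃[ E ] (Extension σ F E × a ∈ E))
  credulous {F} fr = ⊨-⟨makeExtBy⟩ (characterises-Extension F σ) fr a
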